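{- Let $P$ be a map and let $M$ be its phial, and suppose $G_M$ is connected. Then $\chi(P)\le 3-|V(G_M)|+\gamma$, where $\gamma$ is the dimension of the bicycle space of $G_M$. Moreover, equality holds if and only if $P$ is rich.
   Context: A map is a triple $X=(C_X,v_X,f_X)$ where $C_X$ is a finite cubic graph (multiple edges allowed) and $v_X,f_X$ are disjoint perfect matchings whose union is a disjoint union of 4-cycles, the squares of $X$. $a_X=E(C_X)\setminus(v_X\cup f_X)$; $z_X$ is the matching of square diagonals; $Q_X=C_X\cup z_X$. $\chi(X)=\#\{\text{cycles of }v_X\cup a_X\}-\#\text{squares}+\#\{\text{cycles of }f_X\cup a_X\}$. $G_X$ has vertices the cycles of $v_X\cup a_X$ and edges the squares, each joining the cycles containing its two $v_X$-edges. The dual of $X$ is $(C_X,f_X,v_X)$ and the phial is $(Q_X\setminus v_X,z_X,f_X)$ (the phial of the phial is $X$). Edge sets of the graphs of $X$, its dual $D$ and phial are identified with the squares; $V_X,F_X,Z_X$ are their $GF(2)$-coboundary spaces; with $\perp$ w.r.t. $|A\cap B|\bmod 2$, $V_X^\perp$ is the cycle space of $G_X$; one has $F_X+Z_X\subseteq V_X^\perp$, and $X$ is rich if $V_X^\perp=F_X+Z_X$. The bicycle space of a graph is the intersection of its cycle and coboundary spaces. -}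

module Defs where

open import Data.Bool using (Bool; _xor_; if_then_else_)
open import Data.Fin using (Fin; _≟_; punchIn; punchOut)
open import Data.Fin.Properties
  using (punchInᵢ≢i; punchOut-punchIn; punchOut-cong; punchOut-injective)
open import Data.Fin.Subset using (Subset; ⊥; _∩_; ∣_∣)
open import Data.Integer as ℤ using (ℤ; +_)
open import Data.List using (List; []; _∷_; _++_; map; allFin)
open import Data.List.Membership.Propositional using (_∈_)
open import Data.List.Membership.Propositional.Properties
  using (∈-map⁺; ∈-map⁻; ∈-++⁺ˡ; ∈-++⁺ʳ; ∈-++⁻; ∈-allFin)
open import Data.List.Relation.Unary.Any using (here; there)
open import Data.Nat using (ℕ; zero; suc; _+_; NonZero)
open import Data.Nat.Divisibility using (_∣_)
open import Data.Product using (Σ; ∃-syntax; _×_; _,_; proj₁; proj₂)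
open import Data.Sum using (_⊎_; inj₁; inj₂)
open import Data.Vec using (Vec; []; _∷_; lookup; tabulate; zipWith)
open import Level using (0ℓ)
open import Relation.Binary using (Rel)
open import Relation.Binary.Construct.Closure.Equivalence as Eq using (EqClosure)
open import Relation.Binary.Construct.Closure.ReflexiveTransitive using (ε)
open import Relation.Binary.PropositionalEquality
open import Relation.Nullary using (yes; no; contradiction)
open import Relation.Nullary.Decidable using (⌊_⌋)
open import Relation.Unary using (Pred; _≐_)
  renaming (_∈_ to _∈ₚ_; _∩_ to _∩ₚ_)

record Classes {n : ℕ} (_~_ : Rel (Fin n) 0ℓ) : Set where
  field
    count     : ℕ
    class     : Fin n → Fin count
    rep       : Fin count → Fin n
    class-rep : ∀ c → class (rep c) ≡ c
    sound     : ∀ {x y} → x ~ y → class x ≡ class y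
    exact     : ∀ {x y} → class x ≡ class y → x ~ y

Listed : {n : ℕ} → List (Fin n × Fin n) → Rel (Fin n) 0ℓ
Listed L x y = (x , y) ∈ L

private
  merge : ∀ {n} {x y : Fin n} {L : List (Fin n × Fin n)} →
          Classes (EqClosure (Listed L)) → Classes (EqClosure (Listed ((x , y) ∷ L)))
  merge {n} {x} {y} {L} Q with Classes.class Q x ≟ Classes.class Q y
  ... | yes x≡y = record
    { count = count ; class = class ; rep = rep ; class-rep = class-rep
    ; sound = Eq.gfold isEquivalence class gen
    ; exact = λ e → Eq.map there (exact e)
    }
    where
    open Classes Q
    gen : ∀ {u w} → Listed ((x , y) ∷ L) u w → class u ≡ class w
    gen (here refl) = x≡y
    gen (there u∈L) = sound (Eq.return u∈L)
  merge {n} {x} {y} {L} Q | no x≢y = go Q x≢y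
    where
    _≈_ : Rel (Fin n) 0ℓ
    _≈_ = EqClosure (Listed ((x , y) ∷ L))

    x≈y : x ≈ y
    x≈y = Eq.return (here refl)

    go : (Q : Classes (EqClosure (Listed L))) → Classes.class Q x ≢ Classes.class Q y →
         Classes _≈_
    go record { count = zero ; class = class } _ with () ← class x
    go record { count = suc k ; class = class ; rep = rep ; class-rep = class-rep
              ; sound = sound ; exact = exact } x≢y = record
      { count = k
      ; class = λ u → drop (class u)
      ; rep = λ c → rep (punchIn (class y) c)
      ; class-rep = λ c → trans (cong drop (class-rep _)) (drop-punchIn c)
      ; sound = Eq.gfold isEquivalence (λ u → drop (class u)) gen
      ; exact = λ {u} {w} → ex u w
      }
      where
      y≢x : class y ≢ class x
      y≢x e = x≢y (sym e)

      drop : Fin (suc k) → Fin k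
      drop c with class y ≟ c
      ... | yes _   = punchOut y≢x
      ... | no  y≢c = punchOut y≢c

      drop-y : drop (class y) ≡ punchOut y≢x
      drop-y with class y ≟ class y
      ... | yes _   = refl
      ... | no  y≢y = contradiction refl y≢y

      drop-x : drop (class x) ≡ punchOut y≢x
      drop-x with class y ≟ class x
      ... | yes _ = refl
      ... | no  _ = punchOut-cong (class y) refl

      drop-punchIn : ∀ c → drop (punchIn (class y) c) ≡ c
      drop-punchIn c with class y ≟ punchIn (class y) c
      ... | yes e = contradiction (sym e) (punchInᵢ≢i (class y) c)
      ... | no  _ = trans (punchOut-cong (class y) refl) (punchOut-punchIn (class y))

      gen : ∀ {u w} → Listed ((x , y) ∷ L) u w → drop (class u) ≡ drop (class w)
      gen (here refl) = trans drop-x (sym drop-y)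
      gen (there u∈L) = cong drop (sound (Eq.return u∈L))

      lift : ∀ {u w} → class u ≡ class w → u ≈ w
      lift e = Eq.map there (exact e)

      ex : ∀ u w → drop (class u) ≡ drop (class w) → u ≈ w
      ex u w e with class y ≟ class u | class y ≟ class w
      ... | yes y~u | yes y~w = lift (trans (sym y~u) y~w)
      ... | yes y~u | no  y≁w = Eq.transitive _ (lift (sym y~u))
              (Eq.transitive _ (Eq.symmetric _ x≈y) (lift (punchOut-injective y≢x y≁w e)))
      ... | no  y≁u | yes y~w = Eq.transitive _ (lift (punchOut-injective y≁u y≢x e))
              (Eq.transitive _ x≈y (lift y~w))
      ... | no  y≁u | no  y≁w = lift (punchOut-injective y≁u y≁w e)

classesOfList : ∀ {n} (L : List (Fin n × Fin n)) → Classes (EqClosure (Listed L))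
classesOfList [] = record
  { count = _ ; class = λ x → x ; rep = λ x → x ; class-rep = λ _ → refl
  ; sound = Eq.fold isEquivalence (λ ()) ; exact = λ { refl → ε } }
classesOfList (_ ∷ L) = merge (classesOfList L)

-- The edges are {x, mate x}.
record PerfectMatching (n : ℕ) : Set where
  field
    mate       : Fin n → Fin n
    involutive : ∀ x → mate (mate x) ≡ x
    irreflex   : ∀ x → mate x ≢ x

open PerfectMatching public

-- The union of two perfect matchings is 2-regular (an edge lying in both
-- being doubled), so its cycles are its connected components.

module _ {n : ℕ} (p q : PerfectMatching n) where

  Joined : Rel (Fin n) 0ℓ
  Joined x y = (mate p x ≡ y) ⊎ (mate q x ≡ y)

  SameCycle : Rel (Fin n) 0ℓ
  SameCycle = EqClosure Joined

  private
    edges : List (Fin n × Fin n)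
    edges = map (λ x → x , mate p x) (allFin n) ++ map (λ x → x , mate q x) (allFin n)

    to : ∀ {x y} → Listed edges x y → Joined x y
    to xy∈ with ∈-++⁻ (map (λ x → x , mate p x) (allFin n)) xy∈
    ... | inj₁ h with (_ , _ , refl) ← ∈-map⁻ _ h = inj₁ refl
    ... | inj₂ h with (_ , _ , refl) ← ∈-map⁻ _ h = inj₂ refl

    from : ∀ {x y} → Joined x y → Listed edges x y
    from {x} (inj₁ refl) = ∈-++⁺ˡ (∈-map⁺ (λ x → x , mate p x) (∈-allFin x))
    from {x} (inj₂ refl) = ∈-++⁺ʳ _ (∈-map⁺ (λ x → x , mate q x) (∈-allFin x))

  cycles : Classes SameCycle
  cycles = record
    { count = C.count ; class = C.class ; rep = C.rep ; class-rep = C.class-rep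
    ; sound = λ h → C.sound (Eq.map from h)
    ; exact = λ e → Eq.map to (C.exact e)
    }
    where module C = Classes (classesOfList edges)

-- Removing the disjoint perfect matchings v and f from the cubic graph C leaves
-- a third perfect matching a.  So the triple (C , v , f) is given by v, f and a,
-- and E(C) is their disjoint union: an edge of a may be parallel to an edge of
-- v or f.  No edges of v and f are parallel, since they would form a 2-cycle.
-- The walk alternating between v and f closes up after four steps.

record Map (n : ℕ) : Set where
  field
    v f a    : PerfectMatching n
    disjoint : ∀ x → mate v x ≢ mate f x
    square   : ∀ x → mate f (mate v (mate f (mate v x))) ≡ x

  square′ : ∀ x → mate v (mate f (mate v (mate f x))) ≡ x
  square′ x = begin
    mate v (mate f (mate v (mate f x)))                    ≡⟨ involutive f _ ⟨
    mate f (mate f (mate v (mate f (mate v (mate f x)))))  ≡⟨ cong (mate f) (square (mate f x)) ⟩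
    mate f (mate f x)                                      ≡⟨ involutive f x ⟩
    x                                                      ∎
    where open ≡-Reasoning

  z : PerfectMatching n
  z = record
    { mate       = λ x → mate v (mate f x)
    ; involutive = square′
    ; irreflex   = λ x e → disjoint x
        (trans (cong (mate v) (sym e)) (involutive v (mate f x)))
    }

  squares : Classes (SameCycle v f)
  squares = cycles v f

  #squares : ℕ
  #squares = Classes.count squares

dual : ∀ {n} → Map n → Map n
dual X = record
  { v = f ; f = v ; a = a
  ; disjoint = λ x e → disjoint x (sym e)
  ; square = square′
  }
  where open Map X

-- Q_X has edge set v ∪ f ∪ a ∪ z, so deleting v and then the new matchings z
-- and f leaves a again.

phial : ∀ {n} → Map n → Map n
phial X = record
  { v = z ; f = f ; a = a
  ; disjoint = λ x → irreflex v (mate f x)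
  ; square = λ x → begin
      mate f (mate v (mate f (mate f (mate v (mate f x)))))
        ≡⟨ cong (λ y → mate f (mate v y)) (involutive f _) ⟩
      mate f (mate v (mate v (mate f x)))
        ≡⟨ cong (mate f) (involutive v _) ⟩
      mate f (mate f x)
        ≡⟨ involutive f x ⟩
      x ∎
  }
  where
  open Map X
  open ≡-Reasoning

χ : ∀ {n} → Map n → ℤ
χ X = + Classes.count (cycles v a) ℤ.- + #squares ℤ.+ + Classes.count (cycles f a)
  where open Map X

-- Loops and multiple edges are allowed.
record Graph : Set where
  field
    #V #E : ℕ
    ends  : Fin #E → Fin #V × Fin #V

  Adjacent : Rel (Fin #V) 0ℓ
  Adjacent u w = ∃[ e ] ends e ≡ (u , w)

  -- The graph without vertices is not connected.
  Connected : Set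
  Connected = NonZero #V × (∀ u w → EqClosure Adjacent u w)

-- The v-edges of the square through x are {x, v x} and {f x, v (f x)}.

G : ∀ {n} → Map n → Graph
G X = record
  { #V   = C.count
  ; #E   = #squares
  ; ends = λ s → C.class (S.rep s) , C.class (mate f (S.rep s))
  }
  where
  open Map X
  module C = Classes (cycles v a)
  module S = Classes squares

-- A GF(2)-space is given by its members; the sum of two subsets is ⊕.
Space : ℕ → Set₁
Space m = Pred (Subset m) 0ℓ

infixl 6 _⊕_

_⊕_ : ∀ {m} → Subset m → Subset m → Subset m
_⊕_ = zipWith _xor_

infixl 6 _+ₛ_

_+ₛ_ : ∀ {m} → Space m → Space m → Space m
(U +ₛ W) A = ∃[ B ] ∃[ C ] (B ∈ₚ U × C ∈ₚ W × B ⊕ C ≡ A)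

infix 8 _^⊥

_^⊥ : ∀ {m} → Space m → Space m
(W ^⊥) A = ∀ B → B ∈ₚ W → 2 ∣ ∣ A ∩ B ∣

combination : ∀ {m d} → Vec Bool d → Vec (Subset m) d → Subset m
combination []      []      = ⊥
combination (c ∷ cs) (B ∷ Bs) = (if c then B else ⊥) ⊕ combination cs Bs

record IsBasis {m d : ℕ} (W : Space m) (Bs : Vec (Subset m) d) : Set where
  field
    members     : ∀ i → lookup Bs i ∈ₚ W
    independent : ∀ cs → combination cs Bs ≡ ⊥ → cs ≡ ⊥
    spanning    : ∀ A → A ∈ₚ W → ∃[ cs ] combination cs Bs ≡ A

HasDimension : ∀ {m} → Space m → ℕ → Set
HasDimension {m} W d = Σ (Vec (Subset m) d) (IsBasis W)

module _ (Γ : Graph) where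
  open Graph Γ

  -- An edge lies in δ U when exactly one of its ends is in U; never for a loop.
  δ : Subset #V → Subset #E
  δ U = tabulate λ e → lookup U (proj₁ (ends e)) xor lookup U (proj₂ (ends e))

  Coboundaries : Space #E
  Coboundaries A = ∃[ U ] δ U ≡ A

  -- A loop at u contributes 2.
  degree : Subset #E → Fin #V → ℕ
  degree A u = ∣ A ∩ tabulate (λ e → ⌊ proj₁ (ends e) ≟ u ⌋) ∣
             + ∣ A ∩ tabulate (λ e → ⌊ proj₂ (ends e) ≟ u ⌋) ∣

  Cycles : Space #E
  Cycles A = ∀ u → 2 ∣ degree A u

  Bicycles : Space #E
  Bicycles = Cycles ∩ₚ Coboundaries

-- X, its dual and its phial have the same squares as vertex sets, but their
-- squares are numbered separately; transfer X Y turns a set of squares of X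
-- into the corresponding set of squares of Y.

transfer : ∀ {n} (X Y : Map n) → Subset (Map.#squares X) → Subset (Map.#squares Y)
transfer X Y A = tabulate λ t →
  lookup A (Classes.class (Map.squares X) (Classes.rep (Map.squares Y) t))

module _ {n : ℕ} (X : Map n) where

  𝓥 𝓕 𝓩 : Space (Map.#squares X)
  𝓥 = Coboundaries (G X)
  𝓕 A = transfer X (dual X) A ∈ₚ Coboundaries (G (dual X))
  𝓩 A = transfer X (phial X) A ∈ₚ Coboundaries (G (phial X))

  Rich : Set
  Rich = 𝓥 ^⊥ ≐ 𝓕 +ₛ 𝓩

{-# OPTIONS --safe #-}

-- Write V, F, Z for the spaces of P and m for the number of squares, and let K be
-- the bicycle space of G M, so that K = Z ∩ Z^⊥.  The three spaces are pairwise
-- orthogonal, and V ∩ Z ⊆ F.  As P is connected, their dimensions are the numbers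
-- of vertices of the three graphs less one, so the claim reads
-- dim V + dim F + dim Z ≤ m + dim K.  This follows from
-- dim F + dim Z = dim (F + Z) + dim (F ∩ Z), F + Z ⊆ V^⊥ and F ∩ Z ⊆ K, and
-- equality forces F + Z = V^⊥.  Conversely, if F + Z = V^⊥ then a member of K is
-- orthogonal to F + Z, so it lies in V^⊥⊥ = V, and then in V ∩ Z ⊆ F.
-- Dimensions are compared by counting: a space of dimension d has 2 ^ d members.

module Submission where

open import Defs
open import Data.Nat using (ℕ)
open import Data.Integer using (+_; _+_; _-_; _≤_)
open import Data.Product using (_×_)
open import Function.Bundles using (_⇔_)
open import Relation.Binary.PropositionalEquality using (_≡_)

open import Algebra.Bundles using (AbelianGroup; CommutativeRing)
open import Data.Bool as Bool using (Bool; true; false; not; _∧_; _xor_; if_then_else_)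
open import Data.Bool.Properties
  using ( xor-assoc; xor-comm; xor-same; xor-identityʳ; ∧-comm; ∧-zeroʳ; ∧-identityʳ
        ; ∧-distribˡ-xor; xor-∧-commutativeRing)
open import Data.Bool.Solver using (module xor-∧-Solver)
open import Data.Fin as Fin using (Fin; zero; suc; _≟_; _<?_)
open import Data.Fin.Permutation using (permutation)
import Data.Fin.Properties as Fin
open import Data.Fin.Subset using (Subset; ⊥; ⊤; _∩_; ∣_∣)
open import Data.Fin.Subset.Properties using (anySubset?)
import Data.Integer as ℤ
import Data.Integer.Properties as ℤ
import Data.Integer.Tactic.RingSolver as ℤ
open import Data.Nat as ℕ using (zero; suc; _*_; _^_; z≤n)
open import Data.Nat.Divisibility using (_∣_; divides)
import Data.Nat.Properties as ℕ
import Data.Nat.Tactic.RingSolver as ℕ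
open import Data.Product using (_,_; proj₁; proj₂; ∃-syntax)
open import Data.Sum using (inj₁; inj₂)
open import Data.Vec using (Vec; []; _∷_; lookup; tabulate; replicate)
open import Data.Vec.Properties
  using ( ≡-dec; ∷-injectiveʳ; zipWith-assoc; zipWith-comm; zipWith-identityˡ; zipWith-identityʳ
        ; lookup-zipWith; lookup-replicate; lookup∘tabulate; tabulate∘lookup; tabulate-cong)
open import Function using (_∘_)
open import Function.Bundles using (mk⇔)
open import Relation.Binary using (tri<; tri≈; tri>)
open import Relation.Binary.Construct.Closure.Equivalence as Eq using ()
open import Relation.Binary.PropositionalEquality hiding (_≡_)
open import Relation.Nullary using (¬_; Dec; yes; no; does; contradiction)
open import Relation.Nullary.Decidable
  using (⌊_⌋; isYes≗does; dec-true; dec-false; map′; ¬?; _×-dec_)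
open import Relation.Unary using (Decidable)
open import Algebra.Properties.CommutativeSemigroup ℕ.+-commutativeSemigroup using (interchange)
open import Algebra.Properties.Group (AbelianGroup.group ℤ.+-0-abelianGroup) using (∙-cancelʳ)
open import Algebra.Properties.Semiring.Sum (CommutativeRing.semiring xor-∧-commutativeRing)
  using (sum; sum-cong-≗; ∑-distrib-+; ∑-comm; sum-permute; *-distribˡ-sum; sum-replicate-zero)
open ≡-Reasoning
open xor-∧-Solver using (solve; _:=_; _:+_; _:*_)

-- Counting subsets

-- Everything rests on reading a coboundary as a two-colouring of the vertices of the cubic graph.
-- The colourings for V, F and Z are all constant along `a`, and are constant along `v`, `f` and the
-- diagonals `z` respectively. For colourings from two different spaces, the product summed over the
-- four vertices of a square equals the product of the two coboundaries there. Summed over all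
-- squares this runs once over every vertex, and vanishes because `a` pairs vertices with equal
-- values; hence the orthogonality. The inclusion V ∩ Z ⊆ F comes from adding the two colourings
-- instead of multiplying them. The constant 3 is one for each graph: a connected graph has exactly
-- two colourings with zero coboundary, so each size carries a factor 2. A recurring obstacle is
-- that `P`, its dual and its phial number the same squares differently. Sets of squares are
-- therefore compared as functions on the vertices, where the numbering disappears.

xor≡false : ∀ {a b} → a xor b ≡ false → a ≡ b
xor≡false {false} {false} _ = refl
xor≡false {true}  {true}  _ = refl

_≟ₛ_ : ∀ {m} (A B : Subset m) → Dec (A ≡ B)
_≟ₛ_ = ≡-dec Bool._≟_

module _ {m : ℕ} where

  ⊕-assoc : (A B C : Subset m) → (A ⊕ B) ⊕ C ≡ A ⊕ (B ⊕ C)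
  ⊕-assoc = zipWith-assoc xor-assoc

  ⊕-comm : (A B : Subset m) → A ⊕ B ≡ B ⊕ A
  ⊕-comm = zipWith-comm xor-comm

  ⊕-identityˡ : (A : Subset m) → ⊥ ⊕ A ≡ A
  ⊕-identityˡ = zipWith-identityˡ (λ _ → refl)

  ⊕-identityʳ : (A : Subset m) → A ⊕ ⊥ ≡ A
  ⊕-identityʳ = zipWith-identityʳ xor-identityʳ

⊕-same : ∀ {m} (A : Subset m) → A ⊕ A ≡ ⊥
⊕-same []      = refl
⊕-same (a ∷ A) = cong₂ _∷_ (xor-same a) (⊕-same A)

⊕-cancelʳ : ∀ {m} (A B : Subset m) → (A ⊕ B) ⊕ B ≡ A
⊕-cancelʳ A B = begin
  (A ⊕ B) ⊕ B  ≡⟨ ⊕-assoc A B B ⟩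
  A ⊕ (B ⊕ B)  ≡⟨ cong (A ⊕_) (⊕-same B) ⟩
  A ⊕ ⊥        ≡⟨ ⊕-identityʳ A ⟩
  A            ∎

⊕≡⊥⇒≡ : ∀ {m} {A B : Subset m} → A ⊕ B ≡ ⊥ → A ≡ B
⊕≡⊥⇒≡ {A = A} {B} e = begin
  A            ≡⟨ ⊕-cancelʳ A B ⟨
  (A ⊕ B) ⊕ B  ≡⟨ cong (_⊕ B) e ⟩
  ⊥ ⊕ B        ≡⟨ ⊕-identityˡ B ⟩
  B            ∎

record IsSubspace {m : ℕ} (W : Space m) : Set where
  field
    ⊥-∈ : W ⊥
    ⊕-∈ : ∀ {A B} → W A → W B → W (A ⊕ B)

  ⊕-∈⁻ : ∀ {A B} → W B → W (A ⊕ B) → W A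
  ⊕-∈⁻ {A} {B} B∈ A⊕B∈ = subst W (⊕-cancelʳ A B) (⊕-∈ A⊕B∈ B∈)

Linear : ∀ {p q} → (Subset p → Subset q) → Set
Linear φ = ∀ A B → φ (A ⊕ B) ≡ φ A ⊕ φ B

-- The recursion follows the first coordinate, so that translations and orthogonal complements can
-- be treated one coordinate at a time.
total : ∀ {m} → (Subset m → ℕ) → ℕ
total {zero}  f = f []
total {suc m} f = total (λ A → f (false ∷ A)) ℕ.+ total (λ A → f (true ∷ A))

total-cong : ∀ {m} {f g : Subset m → ℕ} → (∀ A → f A ≡ g A) → total f ≡ total g
total-cong {zero}  e = e []
total-cong {suc m} e = cong₂ ℕ._+_
  (total-cong (λ A → e (false ∷ A))) (total-cong (λ A → e (true ∷ A)))

total-+ : ∀ {m} (f g : Subset m → ℕ) → total (λ A → f A ℕ.+ g A) ≡ total f ℕ.+ total g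
total-+ {zero}  f g = refl
total-+ {suc m} f g = trans
  (cong₂ ℕ._+_
    (total-+ (f ∘ (false ∷_)) (g ∘ (false ∷_)))
    (total-+ (f ∘ (true ∷_)) (g ∘ (true ∷_))))
  (interchange (total (f ∘ (false ∷_))) _ _ _)

total-* : ∀ {m} (f : Subset m → ℕ) k → total (λ A → f A * k) ≡ total f * k
total-* {zero}  f k = refl
total-* {suc m} f k = trans
  (cong₂ ℕ._+_ (total-* (f ∘ (false ∷_)) k) (total-* (f ∘ (true ∷_)) k))
  (sym (ℕ.*-distribʳ-+ k (total (f ∘ (false ∷_))) _))

total-0 : ∀ m → total {m} (λ _ → 0) ≡ 0
total-0 zero    = refl
total-0 (suc m) = cong₂ ℕ._+_ (total-0 m) (total-0 m)

total-1 : ∀ m → total {m} (λ _ → 1) ≡ 2 ^ m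
total-1 zero    = refl
total-1 (suc m) = cong₂ ℕ._+_ (total-1 m) (trans (total-1 m) (sym (ℕ.+-identityʳ _)))

total-swap : ∀ {p q} (f : Subset p → Subset q → ℕ) →
             total (λ A → total (λ B → f A B)) ≡ total (λ B → total (λ A → f A B))
total-swap {zero}  f = refl
total-swap {suc p} f = trans
  (cong₂ ℕ._+_ (total-swap (f ∘ (false ∷_))) (total-swap (f ∘ (true ∷_))))
  (sym (total-+ (λ B → total (λ A → f (false ∷ A) B)) _))

-- Translation permutes the subsets: a `true` in `B` swaps the two halves of the sum.
total-shift : ∀ {m} (f : Subset m → ℕ) B → total (λ A → f (A ⊕ B)) ≡ total f
total-shift f []          = refl
total-shift f (false ∷ B) = cong₂ ℕ._+_
  (total-shift (f ∘ (false ∷_)) B) (total-shift (f ∘ (true ∷_)) B)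
total-shift f (true ∷ B)  = trans
  (cong₂ ℕ._+_ (total-shift (f ∘ (true ∷_)) B) (total-shift (f ∘ (false ∷_)) B))
  (ℕ.+-comm (total (f ∘ (true ∷_))) _)

total-mono : ∀ {m} {f g : Subset m → ℕ} → (∀ A → f A ℕ.≤ g A) → total f ℕ.≤ total g
total-mono {zero}  le = le []
total-mono {suc m} le = ℕ.+-mono-≤
  (total-mono (λ A → le (false ∷ A))) (total-mono (λ A → le (true ∷ A)))

-- Termwise inequalities with no slack in the total have no slack in any term; one half is bounded
-- and cancelled to reach the other.
total-mono⁻ : ∀ {m} {f g : Subset m → ℕ} → (∀ A → f A ℕ.≤ g A) → total g ℕ.≤ total f →
              ∀ A → g A ℕ.≤ f A
total-mono⁻ {zero}          le ge []          = ge
total-mono⁻ {suc m} {f} {g} le ge (false ∷ A) = total-mono⁻ (λ A → le (false ∷ A))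
  (ℕ.+-cancelʳ-≤ (total (g ∘ (true ∷_))) _ _
    (ℕ.≤-trans ge (ℕ.+-monoʳ-≤ (total (f ∘ (false ∷_))) (total-mono (λ A → le (true ∷ A)))))) A
total-mono⁻ {suc m} {f} {g} le ge (true ∷ A)  = total-mono⁻ (λ A → le (true ∷ A))
  (ℕ.+-cancelˡ-≤ (total (g ∘ (false ∷_))) _ _
    (ℕ.≤-trans ge (ℕ.+-monoˡ-≤ (total (f ∘ (true ∷_))) (total-mono (λ A → le (false ∷ A)))))) A

term≤total : ∀ {m} (f : Subset m → ℕ) A → f A ℕ.≤ total f
term≤total f []          = ℕ.≤-refl
term≤total f (false ∷ A) = ℕ.≤-trans (term≤total (f ∘ (false ∷_)) A) (ℕ.m≤m+n _ _)
term≤total f (true ∷ A)  = ℕ.≤-trans (term≤total (f ∘ (true ∷_)) A) (ℕ.m≤n+m _ _)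

ι : {P : Set} → Dec P → ℕ
ι P? = if does P? then 1 else 0

ι-yes : {P : Set} (P? : Dec P) → P → ι P? ≡ 1
ι-yes (yes _) _ = refl
ι-yes (no ¬p) p = contradiction p ¬p

ι-no : {P : Set} (P? : Dec P) → ¬ P → ι P? ≡ 0
ι-no (yes p) ¬p = contradiction p ¬p
ι-no (no _)  _  = refl

ι-mono : {P Q : Set} (P? : Dec P) (Q? : Dec Q) → (P → Q) → ι P? ℕ.≤ ι Q?
ι-mono (yes p) Q? f = ℕ.≤-reflexive (sym (ι-yes Q? (f p)))
ι-mono (no _)  Q? f = z≤n

ι-mono⁻ : {P Q : Set} (P? : Dec P) (Q? : Dec Q) → ι P? ℕ.≤ ι Q? → P → Q
ι-mono⁻ P?      (yes q) _  _ = q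
ι-mono⁻ P?      (no _)  le p with () ← subst (ℕ._≤ 0) (ι-yes P? p) le

ι-cong : {P Q : Set} (P? : Dec P) (Q? : Dec Q) → (P → Q) → (Q → P) → ι P? ≡ ι Q?
ι-cong P? Q? f g = ℕ.≤-antisym (ι-mono P? Q? f) (ι-mono Q? P? g)

ι-× : {P Q : Set} (P? : Dec P) (Q? : Dec Q) → ι (P? ×-dec Q?) ≡ ι P? * ι Q?
ι-× (yes _) (yes _) = refl
ι-× (yes _) (no _)  = refl
ι-× (no _)  _       = refl

size : ∀ {m} {W : Space m} → Decidable W → ℕ
size W? = total (λ A → ι (W? A))

module _ {m : ℕ} {V W : Space m} (V? : Decidable V) (W? : Decidable W) where

  size-mono : (∀ A → V A → W A) → size V? ℕ.≤ size W?
  size-mono V⊆W = total-mono (λ A → ι-mono (V? A) (W? A) (V⊆W A))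

  -- This is how equality of dimensions becomes equality of spaces.
  size-mono⁻ : (∀ A → V A → W A) → size W? ℕ.≤ size V? → ∀ A → W A → V A
  size-mono⁻ V⊆W le A = ι-mono⁻ (W? A) (V? A)
    (total-mono⁻ (λ A → ι-mono (V? A) (W? A) (V⊆W A)) le A)

  size-cong : (∀ A → V A → W A) → (∀ A → W A → V A) → size V? ≡ size W?
  size-cong f g = total-cong (λ A → ι-cong (V? A) (W? A) (f A) (g A))

size≢0 : ∀ {m} {W : Space m} (W? : Decidable W) → W ⊥ → ℕ.NonZero (size W?)
size≢0 W? ⊥∈ = ℕ.>-nonZero (subst (ℕ._≤ size W?) (ι-yes (W? ⊥) ⊥∈) (term≤total (λ A → ι (W? A)) ⊥))

size-singleton : ∀ {m} (B : Subset m) → size (_≟ₛ B) ≡ 1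
size-singleton []          = refl
size-singleton {suc m} (false ∷ B) = cong₂ ℕ._+_
  (trans (total-cong (λ A →
           ι-cong ((false ∷ A) ≟ₛ (false ∷ B)) (A ≟ₛ B) ∷-injectiveʳ (cong (false ∷_))))
         (size-singleton B))
  (trans (total-cong (λ A → ι-no ((true ∷ A) ≟ₛ (false ∷ B)) (λ ()))) (total-0 m))
size-singleton {suc m} (true ∷ B)  = cong₂ ℕ._+_
  (trans (total-cong (λ A → ι-no ((false ∷ A) ≟ₛ (true ∷ B)) (λ ()))) (total-0 m))
  (trans (total-cong (λ A →
           ι-cong ((true ∷ A) ≟ₛ (true ∷ B)) (A ≟ₛ B) ∷-injectiveʳ (cong (true ∷_))))
         (size-singleton B))

-- Rank and nullity as a count: the pairs `(A , U)` with `A ≡ φ U` are summed in both orders. Each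
-- `U` has one `A`, and the `U` over a given member of `W` form a translate of the kernel.
image-size : ∀ {p q} {φ : Subset p → Subset q} {W : Space q} (W? : Decidable W) → Linear φ →
             (∀ U → W (φ U)) → (∀ A → W A → ∃[ U ] φ U ≡ A) →
             size W? * size (λ U → φ U ≟ₛ ⊥) ≡ 2 ^ p
image-size {p} {q} {φ} {W} W? linear into onto = begin
  size W? * k                                    ≡⟨ total-* (λ A → ι (W? A)) k ⟨
  total (λ A → ι (W? A) * k)                     ≡⟨ total-cong fibre ⟩
  total (λ A → total (λ U → ι (A ≟ₛ φ U)))       ≡⟨ total-swap (λ A U → ι (A ≟ₛ φ U)) ⟩
  total (λ U → size (_≟ₛ φ U))                   ≡⟨ total-cong (λ U → size-singleton (φ U)) ⟩
  total {p} (λ _ → 1)                            ≡⟨ total-1 p ⟩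
  2 ^ p                                          ∎
  where
  k = size (λ U → φ U ≟ₛ ⊥)

  fibre : ∀ A → ι (W? A) * k ≡ total (λ U → ι (A ≟ₛ φ U))
  fibre A with W? A
  ... | no A∉  = sym (trans
    (total-cong (λ U → ι-no (A ≟ₛ φ U) (λ e → A∉ (subst W (sym e) (into U))))) (total-0 p))
  ... | yes A∈ with (U₀ , refl) ← onto A A∈ = begin
    k ℕ.+ 0                                ≡⟨ ℕ.+-identityʳ k ⟩
    k                                      ≡⟨ total-shift (λ U → ι (φ U ≟ₛ ⊥)) U₀ ⟨
    total (λ U → ι (φ (U ⊕ U₀) ≟ₛ ⊥))      ≡⟨ total-cong shifted ⟩
    total (λ U → ι (φ U₀ ≟ₛ φ U))          ∎
    where
    shifted : ∀ U → ι (φ (U ⊕ U₀) ≟ₛ ⊥) ≡ ι (φ U₀ ≟ₛ φ U)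
    shifted U = ι-cong (φ (U ⊕ U₀) ≟ₛ ⊥) (φ U₀ ≟ₛ φ U)
      (λ e → sym (⊕≡⊥⇒≡ (trans (sym (linear U U₀)) e)))
      (λ e → trans (linear U U₀) (trans (cong (φ U ⊕_) e) (⊕-same (φ U))))

module _ {m : ℕ} {U W : Space m} (U? : Decidable U) (W? : Decidable W) where

  +ₛ? : Decidable (U +ₛ W)
  +ₛ? A = anySubset? λ B → anySubset? λ C → U? B ×-dec (W? C ×-dec ((B ⊕ C) ≟ₛ A))

  ∩? : Decidable (λ A → U A × W A)
  ∩? A = U? A ×-dec W? A

  -- The pairs (A , C) with A ⊕ C ∈ U and C ∈ W are counted in both orders.
  size-+ₛ : IsSubspace U → IsSubspace W → size +ₛ? * size ∩? ≡ size U? * size W?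
  size-+ₛ U-sub W-sub = begin
    size +ₛ? * k
      ≡⟨ total-* (λ A → ι (+ₛ? A)) k ⟨
    total (λ A → ι (+ₛ? A) * k)
      ≡⟨ total-cong fibre ⟩
    total (λ A → total (λ C → ι (U? (A ⊕ C)) * ι (W? C)))
      ≡⟨ total-swap (λ A C → ι (U? (A ⊕ C)) * ι (W? C)) ⟩
    total (λ C → total (λ A → ι (U? (A ⊕ C)) * ι (W? C)))
      ≡⟨ total-cong (λ C → trans (total-* (λ A → ι (U? (A ⊕ C))) (ι (W? C)))
           (trans (cong (_* ι (W? C)) (total-shift (λ A → ι (U? A)) C)) (ℕ.*-comm (size U?) _))) ⟩
    total (λ C → ι (W? C) * size U?)
      ≡⟨ total-* (λ C → ι (W? C)) (size U?) ⟩
    size W? * size U?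
      ≡⟨ ℕ.*-comm (size W?) _ ⟩
    size U? * size W?
      ∎
    where
    module U = IsSubspace U-sub
    module W = IsSubspace W-sub
    k = size ∩?

    pair? : ∀ A C → Dec (U (A ⊕ C) × W C)
    pair? A C = U? (A ⊕ C) ×-dec W? C

    fibre : ∀ A → ι (+ₛ? A) * k ≡ total (λ C → ι (U? (A ⊕ C)) * ι (W? C))
    fibre A with +ₛ? A
    ... | no A∉ = sym (trans
      (total-cong (λ C → trans (sym (ι-× (U? (A ⊕ C)) (W? C)))
        (ι-no (pair? A C) (λ (p , q) → A∉ (A ⊕ C , C , p , q , ⊕-cancelʳ A C)))))
      (total-0 m))
    -- Translation by `C₀` carries the intersection onto the `C` that split `B₀ ⊕ C₀`, because
    -- `(B₀ ⊕ C₀) ⊕ (C ⊕ C₀)` is `C ⊕ B₀`.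
    ... | yes (B₀ , C₀ , B₀∈ , C₀∈ , refl) = begin
      k ℕ.+ 0
        ≡⟨ ℕ.+-identityʳ k ⟩
      k
        ≡⟨ total-cong (λ C → ι-cong (∩? C) (pair? A (C ⊕ C₀))
             (λ (p , q) → subst U (sym (shifted C)) (U.⊕-∈ p B₀∈) , W.⊕-∈ q C₀∈)
             (λ (p , q) → U.⊕-∈⁻ B₀∈ (subst U (shifted C) p) , W.⊕-∈⁻ C₀∈ q)) ⟩
      total (λ C → ι (pair? A (C ⊕ C₀)))
        ≡⟨ total-shift (λ C → ι (pair? A C)) C₀ ⟩
      total (λ C → ι (pair? A C))
        ≡⟨ total-cong (λ C → ι-× (U? (A ⊕ C)) (W? C)) ⟩
      total (λ C → ι (U? (A ⊕ C)) * ι (W? C))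
        ∎
      where
      shifted : ∀ C → (B₀ ⊕ C₀) ⊕ (C ⊕ C₀) ≡ C ⊕ B₀
      shifted C = begin
        (B₀ ⊕ C₀) ⊕ (C ⊕ C₀)  ≡⟨ ⊕-assoc (B₀ ⊕ C₀) C C₀ ⟨
        ((B₀ ⊕ C₀) ⊕ C) ⊕ C₀  ≡⟨ cong (_⊕ C₀) (⊕-comm (B₀ ⊕ C₀) C) ⟩
        (C ⊕ (B₀ ⊕ C₀)) ⊕ C₀  ≡⟨ cong (_⊕ C₀) (⊕-assoc C B₀ C₀) ⟨
        ((C ⊕ B₀) ⊕ C₀) ⊕ C₀  ≡⟨ ⊕-cancelʳ (C ⊕ B₀) C₀ ⟩
        C ⊕ B₀                ∎

-- Orthogonality over GF(2)

infix 7 _·_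

-- The parity of the intersection, written as a sum in the field of Booleans so that finite sums can
-- be exchanged, permuted and distributed.
_·_ : ∀ {m} → Subset m → Subset m → Bool
A · B = sum (λ i → lookup A i ∧ lookup B i)

·-comm : ∀ {m} (A B : Subset m) → A · B ≡ B · A
·-comm A B = sum-cong-≗ (λ i → ∧-comm (lookup A i) (lookup B i))

·-⊕ : ∀ {m} (A B C : Subset m) → A · (B ⊕ C) ≡ A · B xor A · C
·-⊕ A B C = trans
  (sum-cong-≗ (λ i → trans (cong (lookup A i ∧_) (lookup-zipWith _xor_ i B C))
                           (∧-distribˡ-xor (lookup A i) (lookup B i) (lookup C i))))
  (∑-distrib-+ (λ i → lookup A i ∧ lookup B i) (λ i → lookup A i ∧ lookup C i))

odd : ℕ → Bool
odd zero    = false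
odd (suc k) = not (odd k)

odd-+ : ∀ k l → odd (k ℕ.+ l) ≡ odd k xor odd l
odd-+ zero    l = refl
odd-+ (suc k) l = trans (cong not (odd-+ k l)) (not-xor (odd k) (odd l))
  where
  not-xor : ∀ a b → not (a xor b) ≡ not a xor b
  not-xor false b     = refl
  not-xor true  false = refl
  not-xor true  true  = refl

even⇒2∣ : ∀ k → odd k ≡ false → 2 ∣ k
even⇒2∣ zero          _ = divides 0 refl
even⇒2∣ (suc (suc k)) e with odd k in eq
... | false with divides q refl ← even⇒2∣ k eq = divides (suc q) refl

2∣⇒even : ∀ k → 2 ∣ k → odd k ≡ false
2∣⇒even _ (divides zero    refl) = refl
2∣⇒even _ (divides (suc q) refl) = cong (not ∘ not) (2∣⇒even _ (divides q refl))

odd-∣∩∣ : ∀ {m} (A B : Subset m) → odd ∣ A ∩ B ∣ ≡ A · B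
odd-∣∩∣ []          []          = refl
odd-∣∩∣ (false ∷ A) (b ∷ B)     = odd-∣∩∣ A B
odd-∣∩∣ (true ∷ A)  (false ∷ B) = odd-∣∩∣ A B
odd-∣∩∣ (true ∷ A)  (true ∷ B)  = cong not (odd-∣∩∣ A B)

module _ {m : ℕ} {W : Space m} where

  ^⊥⇒·≡false : ∀ A → (W ^⊥) A → ∀ {B} → W B → A · B ≡ false
  ^⊥⇒·≡false A A⊥ {B} B∈ = trans (sym (odd-∣∩∣ A B)) (2∣⇒even _ (A⊥ B B∈))

  ·≡false⇒^⊥ : ∀ A → (∀ {B} → W B → A · B ≡ false) → (W ^⊥) A
  ·≡false⇒^⊥ A h B B∈ = even⇒2∣ _ (trans (odd-∣∩∣ A B) (h B∈))

  ^⊥-isSubspace : IsSubspace (W ^⊥)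
  ^⊥-isSubspace = record
    { ⊥-∈ = ·≡false⇒^⊥ ⊥ (λ {B} B∈ → trans (·-comm ⊥ B) (·-⊥ B))
    ; ⊕-∈ = λ {A} {B} A⊥ B⊥ → ·≡false⇒^⊥ (A ⊕ B) (λ {C} C∈ → begin
        (A ⊕ B) · C      ≡⟨ ·-comm (A ⊕ B) C ⟩
        C · (A ⊕ B)      ≡⟨ ·-⊕ C A B ⟩
        C · A xor C · B  ≡⟨ cong₂ _xor_ (·-comm C A) (·-comm C B) ⟩
        A · C xor B · C  ≡⟨ cong₂ _xor_ (^⊥⇒·≡false A A⊥ C∈) (^⊥⇒·≡false B B⊥ C∈) ⟩
        false            ∎)
    }
    where
    ·-⊥ : ∀ (B : Subset m) → B · ⊥ ≡ false
    ·-⊥ B = xor≡x (trans (sym (·-⊕ B ⊥ ⊥)) (cong (B ·_) (⊕-identityˡ ⊥)))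
      where
      xor≡x : ∀ {a} → a xor a ≡ a → a ≡ false
      xor≡x {false} _ = refl

  ^⊥? : Decidable W → Decidable (W ^⊥)
  ^⊥? W? A = map′
    (λ ¬e → ·≡false⇒^⊥ A (λ {B} B∈ → ≢true (λ e → ¬e (B , B∈ , e))))
    (λ A⊥ (B , B∈ , e) → contradiction (trans (sym e) (^⊥⇒·≡false A A⊥ B∈)) λ ())
    (¬? (anySubset? λ B → W? B ×-dec (A · B Bool.≟ true)))
    where
    ≢true : ∀ {b} → b ≢ true → b ≡ false
    ≢true {false} _ = refl
    ≢true {true}  h = contradiction refl h

-- Induction on the ambient dimension: passing to the members of W avoiding the
-- first coordinate halves W if some member has it, and halves W ^⊥ otherwise.
size-^⊥ : ∀ {m} {W : Space m} (W? : Decidable W) (W⊥? : Decidable (W ^⊥)) → IsSubspace W →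
          size W? * size W⊥? ≡ 2 ^ m
size-^⊥ {zero} {W} W? W⊥? sub = cong₂ _*_ (ι-yes (W? []) (IsSubspace.⊥-∈ sub))
  (ι-yes (W⊥? []) (IsSubspace.⊥-∈ ^⊥-isSubspace))
size-^⊥ {suc m} {W} W? W⊥? sub = go (anySubset? (λ A → W? (true ∷ A)))
  where
  open IsSubspace sub
  W₀ : Space m
  W₀ A = W (false ∷ A)
  W₀? : Decidable W₀
  W₀? A = W? (false ∷ A)
  W₀⊥? : Decidable (W₀ ^⊥)
  W₀⊥? = ^⊥? W₀?

  ih : size W₀? * size W₀⊥? ≡ 2 ^ m
  ih = size-^⊥ W₀? W₀⊥? (record { ⊥-∈ = ⊥-∈ ; ⊕-∈ = ⊕-∈ })

  tail-⊥ : ∀ {b C} → (W ^⊥) (b ∷ C) → (W₀ ^⊥) C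
  tail-⊥ {b} {C} h = ·≡false⇒^⊥ C λ {B} B∈ →
    trans (cong (_xor C · B) (sym (∧-zeroʳ b))) (^⊥⇒·≡false (b ∷ C) h B∈)

  go : Dec (∃[ A ] W (true ∷ A)) → size W? * size W⊥? ≡ 2 ^ suc m
  go (yes (A₀ , A₀∈)) = begin
    size W? * size W⊥?                   ≡⟨ cong₂ _*_ W-size ⊥-size ⟩
    (size W₀? ℕ.+ size W₀?) * size W₀⊥?  ≡⟨ ℕ.*-distribʳ-+ (size W₀⊥?) (size W₀?) _ ⟩
    size W₀? * size W₀⊥? ℕ.+ size W₀? * size W₀⊥?
                                         ≡⟨ cong₂ ℕ._+_ ih (trans ih (sym (ℕ.+-identityʳ _))) ⟩
    2 ^ suc m                            ∎
    where
    W-size : size W? ≡ size W₀? ℕ.+ size W₀?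
    W-size = cong (size W₀? ℕ.+_) (trans
      -- Adding `A₀` exchanges the members of `W` with and without the first coordinate.
      (total-cong (λ A → ι-cong (W? (true ∷ A)) (W₀? (A ⊕ A₀)) (λ A∈ → ⊕-∈ A∈ A₀∈) (⊕-∈⁻ A₀∈)))
      (total-shift (λ A → ι (W₀? A)) A₀))

    extends : ∀ {b C} → (W₀ ^⊥) C → b ≡ C · A₀ → (W ^⊥) (b ∷ C)
    extends {b} {C} C⊥ refl = ·≡false⇒^⊥ (b ∷ C) orthogonal
      where
      orthogonal : ∀ {B} → W B → (b ∷ C) · B ≡ false
      orthogonal {false ∷ B} B∈ = trans (cong (_xor C · B) (∧-zeroʳ b)) (^⊥⇒·≡false C C⊥ B∈)
      orthogonal {true ∷ B}  B∈ = begin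
        (C · A₀ ∧ true) xor C · B  ≡⟨ cong (_xor C · B) (∧-identityʳ (C · A₀)) ⟩
        C · A₀ xor C · B           ≡⟨ xor-comm (C · A₀) (C · B) ⟩
        C · B xor C · A₀           ≡⟨ ·-⊕ C B A₀ ⟨
        C · (B ⊕ A₀)               ≡⟨ ^⊥⇒·≡false C C⊥ (⊕-∈ B∈ A₀∈) ⟩
        false                      ∎

    head-⊥ : ∀ {b C} → (W ^⊥) (b ∷ C) → b ≡ C · A₀
    head-⊥ {b} {C} h = xor≡false
      (trans (cong (_xor C · A₀) (sym (∧-identityʳ b))) (^⊥⇒·≡false (b ∷ C) h A₀∈))

    -- Orthogonality to `true ∷ A₀` forces the first coordinate to be `C · A₀`, so each `C` in
    -- `W₀ ^⊥` has exactly one extension in `W ^⊥`.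
    pointwise : ∀ C (C⊥? : Dec ((W₀ ^⊥) C)) b → C · A₀ ≡ b →
                ι (W⊥? (false ∷ C)) ℕ.+ ι (W⊥? (true ∷ C)) ≡ ι C⊥?
    pointwise C (no C∉)  _     _  = cong₂ ℕ._+_
      (ι-no (W⊥? (false ∷ C)) (C∉ ∘ tail-⊥)) (ι-no (W⊥? (true ∷ C)) (C∉ ∘ tail-⊥))
    pointwise C (yes C∈) false eq = cong₂ ℕ._+_
      (ι-yes (W⊥? (false ∷ C)) (extends C∈ (sym eq)))
      (ι-no (W⊥? (true ∷ C)) (λ h → contradiction (trans (head-⊥ h) eq) λ ()))
    pointwise C (yes C∈) true  eq = cong₂ ℕ._+_
      (ι-no (W⊥? (false ∷ C)) (λ h → contradiction (trans (head-⊥ h) eq) λ ()))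
      (ι-yes (W⊥? (true ∷ C)) (extends C∈ (sym eq)))

    ⊥-size : size W⊥? ≡ size W₀⊥?
    ⊥-size = trans (sym (total-+ (λ C → ι (W⊥? (false ∷ C))) (λ C → ι (W⊥? (true ∷ C))))) 
      (total-cong (λ C → pointwise C (W₀⊥? C) (C · A₀) refl))
  go (no none) = begin
    size W? * size W⊥?                      ≡⟨ cong₂ _*_ W-size ⊥-size ⟩
    size W₀? * (size W₀⊥? ℕ.+ size W₀⊥?)    ≡⟨ ℕ.*-distribˡ-+ (size W₀?) (size W₀⊥?) _ ⟩
    size W₀? * size W₀⊥? ℕ.+ size W₀? * size W₀⊥?
                                            ≡⟨ cong₂ ℕ._+_ ih (trans ih (sym (ℕ.+-identityʳ _))) ⟩
    2 ^ suc m                               ∎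
    where
    W-size : size W? ≡ size W₀?
    W-size = trans
      (cong (size W₀? ℕ.+_)
        (trans (total-cong (λ A → ι-no (W? (true ∷ A)) (λ A∈ → none (A , A∈)))) (total-0 m)))
      (ℕ.+-identityʳ _)

    extends : ∀ {b C} → (W₀ ^⊥) C → (W ^⊥) (b ∷ C)
    extends {b} {C} C⊥ = ·≡false⇒^⊥ (b ∷ C) orthogonal
      where
      orthogonal : ∀ {B} → W B → (b ∷ C) · B ≡ false
      orthogonal {false ∷ B} B∈ = trans (cong (_xor C · B) (∧-zeroʳ b)) (^⊥⇒·≡false C C⊥ B∈)
      orthogonal {true ∷ B}  B∈ = contradiction (B , B∈) none

    half : ∀ b → total (λ C → ι (W⊥? (b ∷ C))) ≡ size W₀⊥?
    half b = total-cong (λ C → ι-cong (W⊥? (b ∷ C)) (W₀⊥? C) tail-⊥ extends)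

    ⊥-size : size W⊥? ≡ size W₀⊥? ℕ.+ size W₀⊥?
    ⊥-size = cong₂ ℕ._+_ (half false) (half true)

-- The opposite inclusion is immediate. Applying `size-^⊥` to `W` and to `W ^⊥` and cancelling the
-- nonzero size of `W ^⊥` shows that the two sizes agree.
^⊥^⊥⊆ : ∀ {m} {W : Space m} → Decidable W → IsSubspace W → ∀ A → ((W ^⊥) ^⊥) A → W A
^⊥^⊥⊆ {m} {W} W? sub = size-mono⁻ W? W⊥⊥? W⊆W⊥⊥
  (ℕ.≤-reflexive (ℕ.*-cancelˡ-≡ _ _ (size W⊥?) {{size≢0 W⊥? (IsSubspace.⊥-∈ ^⊥-isSubspace)}}
    (trans (size-^⊥ W⊥? W⊥⊥? ^⊥-isSubspace)
      (trans (sym (size-^⊥ W? W⊥? sub)) (ℕ.*-comm (size W?) _)))))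
  where
  W⊥? : Decidable (W ^⊥)
  W⊥? = ^⊥? W?
  W⊥⊥? : Decidable ((W ^⊥) ^⊥)
  W⊥⊥? = ^⊥? W⊥?
  W⊆W⊥⊥ : ∀ A → W A → ((W ^⊥) ^⊥) A
  W⊆W⊥⊥ A A∈ = ·≡false⇒^⊥ A (λ {B} B⊥ → trans (·-comm A B) (^⊥⇒·≡false B B⊥ A∈))

-- Cycle and coboundary spaces of graphs

sum-false : ∀ {n} {h : Fin n → Bool} → (∀ i → h i ≡ false) → sum h ≡ false
sum-false {n} h≡ = trans (sum-cong-≗ h≡) (sum-replicate-zero n)

sum-delta : ∀ {n} (j : Fin n) (h : Fin n → Bool) → sum (λ i → does (i ≟ j) ∧ h i) ≡ h j
sum-delta {suc n} zero    h =
  trans (cong (h zero xor_) (sum-replicate-zero n)) (xor-identityʳ (h zero))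
sum-delta {suc n} (suc j) h = sum-delta j (h ∘ suc)

lookup-ext : ∀ {m} {A B : Subset m} → (∀ i → lookup A i ≡ lookup B i) → A ≡ B
lookup-ext {A = A} {B} e =
  trans (sym (tabulate∘lookup A)) (trans (tabulate-cong e) (tabulate∘lookup B))

δ-linear : ∀ Γ → Linear (δ Γ)
δ-linear Γ U W = lookup-ext λ e → let (u , w) = ends e in begin
  lookup (δ Γ (U ⊕ W)) e
    ≡⟨ lookup∘tabulate _ e ⟩
  lookup (U ⊕ W) u xor lookup (U ⊕ W) w
    ≡⟨ cong₂ _xor_ (lookup-zipWith _xor_ u U W) (lookup-zipWith _xor_ w U W) ⟩
  (lookup U u xor lookup W u) xor (lookup U w xor lookup W w)
    ≡⟨ solve 4 (λ a b c d → (a :+ b) :+ (c :+ d) := (a :+ c) :+ (b :+ d)) refl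
         (lookup U u) (lookup W u) (lookup U w) (lookup W w) ⟩
  (lookup U u xor lookup U w) xor (lookup W u xor lookup W w)
    ≡⟨ cong₂ _xor_ (lookup∘tabulate _ e) (lookup∘tabulate _ e) ⟨
  lookup (δ Γ U) e xor lookup (δ Γ W) e
    ≡⟨ lookup-zipWith _xor_ e (δ Γ U) (δ Γ W) ⟨
  lookup (δ Γ U ⊕ δ Γ W) e
    ∎
  where open Graph Γ

linear-⊥ : ∀ {p q} {φ : Subset p → Subset q} → Linear φ → φ ⊥ ≡ ⊥
linear-⊥ {φ = φ} linear = begin
  φ ⊥                  ≡⟨ ⊕-cancelʳ (φ ⊥) (φ ⊥) ⟨
  (φ ⊥ ⊕ φ ⊥) ⊕ φ ⊥    ≡⟨ cong (_⊕ φ ⊥) (linear ⊥ ⊥) ⟨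
  φ (⊥ ⊕ ⊥) ⊕ φ ⊥      ≡⟨ cong (λ A → φ A ⊕ φ ⊥) (⊕-identityˡ ⊥) ⟩
  φ ⊥ ⊕ φ ⊥            ≡⟨ ⊕-same (φ ⊥) ⟩
  ⊥                    ∎

preimage-isSubspace : ∀ {p q} {φ : Subset p → Subset q} {W : Space q} →
                      Linear φ → IsSubspace W → IsSubspace (W ∘ φ)
preimage-isSubspace {W = W} linear sub = record
  { ⊥-∈ = subst W (sym (linear-⊥ linear)) ⊥-∈
  ; ⊕-∈ = λ {A} {B} A∈ B∈ → subst W (sym (linear A B)) (⊕-∈ A∈ B∈)
  }
  where open IsSubspace sub

Coboundaries-isSubspace : ∀ Γ → IsSubspace (Coboundaries Γ)
Coboundaries-isSubspace Γ = record
  { ⊥-∈ = ⊥ , linear-⊥ (δ-linear Γ)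
  ; ⊕-∈ = λ { (U , refl) (W , refl) → U ⊕ W , δ-linear Γ U W }
  }

Coboundaries? : ∀ Γ → Decidable (Coboundaries Γ)
Coboundaries? Γ A = anySubset? (λ U → δ Γ U ≟ₛ A)

module _ (Γ : Graph) where
  open Graph Γ

  -- The two incidences of a loop at `u` cancel under `xor`, in accordance with its contribution 2
  -- to the degree.
  odd-degree : ∀ A u → odd (degree Γ A u) ≡
               sum (λ e → lookup A e ∧ (does (proj₁ (ends e) ≟ u) xor does (proj₂ (ends e) ≟ u)))
  odd-degree A u = begin
    odd (degree Γ A u)
      ≡⟨ odd-+ ∣ A ∩ incident proj₁ ∣ _ ⟩
    odd ∣ A ∩ incident proj₁ ∣ xor odd ∣ A ∩ incident proj₂ ∣
      ≡⟨ cong₂ _xor_ (odd-∣∩∣ A (incident proj₁)) (odd-∣∩∣ A (incident proj₂)) ⟩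
    A · incident proj₁ xor A · incident proj₂
      ≡⟨ ∑-distrib-+ (λ e → lookup A e ∧ lookup (incident proj₁) e) _ ⟨
    sum (λ e → (lookup A e ∧ lookup (incident proj₁) e) xor (lookup A e ∧ lookup (incident proj₂) e))
      ≡⟨ sum-cong-≗ (λ e → trans
           (sym (∧-distribˡ-xor (lookup A e) (lookup (incident proj₁) e) (lookup (incident proj₂) e)))
           (cong (lookup A e ∧_) (cong₂ _xor_ (lookup-incident proj₁ e) (lookup-incident proj₂ e)))) ⟩
    sum (λ e → lookup A e ∧ (does (proj₁ (ends e) ≟ u) xor does (proj₂ (ends e) ≟ u)))
      ∎
    where
    incident : (Fin #V × Fin #V → Fin #V) → Subset #E
    incident end = tabulate (λ e → ⌊ end (ends e) ≟ u ⌋)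
    lookup-incident : ∀ end e → lookup (incident end) e ≡ does (end (ends e) ≟ u)
    lookup-incident end e = trans (lookup∘tabulate _ e) (isYes≗does (end (ends e) ≟ u))

  -- The coboundary map is adjoint to the boundary map modulo 2: incidences of edges of `A` with
  -- vertices of `U` are counted by edges and by vertices.
  ·-δ : ∀ A U → A · δ Γ U ≡ sum (λ u → lookup U u ∧ odd (degree Γ A u))
  ·-δ A U = begin
    A · δ Γ U
      ≡⟨ sum-cong-≗ (λ e → cong (lookup A e ∧_) (trans (lookup∘tabulate _ e) (expand e))) ⟩
    sum (λ e → lookup A e ∧ sum (λ u → lookup U u ∧ inc e u))
      ≡⟨ sum-cong-≗ (λ e → trans (*-distribˡ-sum (lookup A e) (λ u → lookup U u ∧ inc e u))
           (sum-cong-≗ (λ u → ∧-swap (lookup A e) (lookup U u) (inc e u)))) ⟩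
    sum (λ e → sum (λ u → lookup U u ∧ (lookup A e ∧ inc e u)))
      ≡⟨ ∑-comm (λ e u → lookup U u ∧ (lookup A e ∧ inc e u)) ⟩
    sum (λ u → sum (λ e → lookup U u ∧ (lookup A e ∧ inc e u)))
      ≡⟨ sum-cong-≗ (λ u → trans (cong (lookup U u ∧_) (odd-degree A u))
           (*-distribˡ-sum (lookup U u) (λ e → lookup A e ∧ inc e u))) ⟨
    sum (λ u → lookup U u ∧ odd (degree Γ A u))
      ∎
    where
    inc : Fin #E → Fin #V → Bool
    inc e u = does (proj₁ (ends e) ≟ u) xor does (proj₂ (ends e) ≟ u)
    ∧-swap : ∀ a b c → a ∧ (b ∧ c) ≡ b ∧ (a ∧ c)
    ∧-swap = solve 3 (λ a b c → a :* (b :* c) := b :* (a :* c)) refl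
    does-sym : ∀ (i j : Fin #V) → does (i ≟ j) ≡ does (j ≟ i)
    does-sym i j with i ≟ j
    ... | yes e = sym (dec-true (j ≟ i) (sym e))
    ... | no ¬e = sym (dec-false (j ≟ i) (¬e ∘ sym))
    pick : ∀ w → lookup U w ≡ sum (λ u → lookup U u ∧ does (w ≟ u))
    pick w = trans (sym (sum-delta w (lookup U))) (sum-cong-≗ (λ u →
      trans (∧-comm (does (u ≟ w)) (lookup U u)) (cong (lookup U u ∧_) (does-sym u w))))
    expand : ∀ e → lookup U (proj₁ (ends e)) xor lookup U (proj₂ (ends e)) ≡
             sum (λ u → lookup U u ∧ inc e u)
    expand e = begin
      lookup U (proj₁ (ends e)) xor lookup U (proj₂ (ends e))
        ≡⟨ cong₂ _xor_ (pick (proj₁ (ends e))) (pick (proj₂ (ends e))) ⟩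
      _ ≡⟨ ∑-distrib-+ (λ u → lookup U u ∧ does (proj₁ (ends e) ≟ u)) _ ⟨
      _ ≡⟨ sum-cong-≗ (λ u → sym (∧-distribˡ-xor (lookup U u) (does (proj₁ (ends e) ≟ u)) _)) ⟩
      sum (λ u → lookup U u ∧ inc e u)
        ∎

  Cycles⇒^⊥ : ∀ A → Cycles Γ A → (Coboundaries Γ ^⊥) A
  Cycles⇒^⊥ A cyc = ·≡false⇒^⊥ A λ { (U , refl) → trans (·-δ A U) (sum-false λ u →
    trans (cong (lookup U u ∧_) (2∣⇒even _ (cyc u))) (∧-zeroʳ (lookup U u))) }

  ^⊥⇒Cycles : ∀ A → (Coboundaries Γ ^⊥) A → Cycles Γ A
  ^⊥⇒Cycles A A⊥ u = even⇒2∣ _ (begin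
    odd (degree Γ A u)
      ≡⟨ sum-delta u (λ w → odd (degree Γ A w)) ⟨
    sum (λ w → does (w ≟ u) ∧ odd (degree Γ A w))
      ≡⟨ sum-cong-≗ (λ w → cong (_∧ odd (degree Γ A w)) (sym (lookup∘tabulate _ w))) ⟩
    sum (λ w → lookup U w ∧ odd (degree Γ A w))
      ≡⟨ ·-δ A U ⟨
    A · δ Γ U
      ≡⟨ ^⊥⇒·≡false A A⊥ (U , refl) ⟩
    false ∎)
    where
    -- The coboundary of the single vertex `u` isolates its degree.
    U : Subset #V
    U = tabulate (λ w → does (w ≟ u))

Bicycles-isSubspace : ∀ Γ → IsSubspace (Bicycles Γ)
Bicycles-isSubspace Γ = record
  { ⊥-∈ = ^⊥⇒Cycles Γ ⊥ Cob⊥.⊥-∈ , Cob.⊥-∈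
  ; ⊕-∈ = λ { {A} {B} (A⊥ , A∈) (B⊥ , B∈) →
      ^⊥⇒Cycles Γ (A ⊕ B) (Cob⊥.⊕-∈ {A} {B} (Cycles⇒^⊥ Γ A A⊥) (Cycles⇒^⊥ Γ B B⊥)) , Cob.⊕-∈ A∈ B∈ }
  }
  where
  module Cob⊥ = IsSubspace (^⊥-isSubspace {W = Coboundaries Γ})
  module Cob = IsSubspace (Coboundaries-isSubspace Γ)

-- Linear combinations

combination-linear : ∀ {m d} (Bs : Vec (Subset m) d) → Linear (λ cs → combination cs Bs)
combination-linear []       []       []       = sym (⊕-same ⊥)
combination-linear (B ∷ Bs) (c ∷ cs) (d ∷ ds) = begin
  (if c xor d then B else ⊥) ⊕ combination (cs ⊕ ds) Bs
    ≡⟨ cong₂ _⊕_ (head c d) (combination-linear Bs cs ds) ⟩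
  ((if c then B else ⊥) ⊕ (if d then B else ⊥)) ⊕ (combination cs Bs ⊕ combination ds Bs)
    ≡⟨ ⊕-interchange _ _ _ _ ⟩
  ((if c then B else ⊥) ⊕ combination cs Bs) ⊕ ((if d then B else ⊥) ⊕ combination ds Bs)
    ∎
  where
  head : ∀ c d → (if c xor d then B else ⊥) ≡ (if c then B else ⊥) ⊕ (if d then B else ⊥)
  head false d     = sym (⊕-identityˡ _)
  head true  false = sym (⊕-identityʳ B)
  head true  true  = sym (⊕-same B)
  ⊕-interchange : ∀ {m} (A B C D : Subset m) → (A ⊕ B) ⊕ (C ⊕ D) ≡ (A ⊕ C) ⊕ (B ⊕ D)
  ⊕-interchange []      []      []      []      = refl
  ⊕-interchange (a ∷ A) (b ∷ B) (c ∷ C) (d ∷ D) = cong₂ _∷_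
    (solve 4 (λ a b c d → (a :+ b) :+ (c :+ d) := (a :+ c) :+ (b :+ d)) refl a b c d)
    (⊕-interchange A B C D)

combination-∈ : ∀ {m d} {W : Space m} → IsSubspace W → (Bs : Vec (Subset m) d) →
                (∀ i → W (lookup Bs i)) → ∀ cs → W (combination cs Bs)
combination-∈ sub []       Bs∈ []           = IsSubspace.⊥-∈ sub
combination-∈ sub (B ∷ Bs) Bs∈ (false ∷ cs) = IsSubspace.⊕-∈ sub (IsSubspace.⊥-∈ sub)
  (combination-∈ sub Bs (Bs∈ ∘ suc) cs)
combination-∈ sub (B ∷ Bs) Bs∈ (true ∷ cs)  = IsSubspace.⊕-∈ sub (Bs∈ zero)
  (combination-∈ sub Bs (Bs∈ ∘ suc) cs)

-- Functions constant on cycles, and sums over squares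

Invariant : ∀ {n} {B : Set} → PerfectMatching n → (Fin n → B) → Set
Invariant p S = ∀ x → S (mate p x) ≡ S x

module _ {n : ℕ} (p q : PerfectMatching n) where

  SameCycle-invariant : {B : Set} {S : Fin n → B} → Invariant p S → Invariant q S →
                        ∀ {x y} → SameCycle p q x y → S x ≡ S y
  SameCycle-invariant {S = S} p-inv q-inv = Eq.gfold isEquivalence S
    λ { {x} (inj₁ refl) → sym (p-inv x) ; {x} (inj₂ refl) → sym (q-inv x) }

  class-invariantˡ : Invariant p (Classes.class (cycles p q))
  class-invariantˡ x = Classes.sound (cycles p q) (Eq.return (inj₁ (involutive p x)))

  class-invariantʳ : Invariant q (Classes.class (cycles p q))
  class-invariantʳ x = Classes.sound (cycles p q) (Eq.return (inj₂ (involutive q x)))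

  rep-invariant : {B : Set} {S : Fin n → B} → Invariant p S → Invariant q S →
                  ∀ x → S (Classes.rep (cycles p q) (Classes.class (cycles p q) x)) ≡ S x
  rep-invariant p-inv q-inv x = SameCycle-invariant p-inv q-inv
    (Classes.exact (cycles p q) (Classes.class-rep (cycles p q) _))

sum-invariant : ∀ {n} (p : PerfectMatching n) {h : Fin n → Bool} → Invariant p h → sum h ≡ false
sum-invariant {n} p {h} inv = begin
  sum h
    ≡⟨ sum-cong-≗ split ⟩
  sum (λ x → lower x xor lower (mate p x))
    ≡⟨ ∑-distrib-+ lower (lower ∘ mate p) ⟩
  sum lower xor sum (lower ∘ mate p)
    ≡⟨ cong (sum lower xor_) (sum-permute lower
         (permutation (mate p) (mate p) (involutive p) (involutive p))) ⟨
  sum lower xor sum lower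
    ≡⟨ xor-same (sum lower) ⟩
  false ∎
  where
  -- Each edge is charged to its smaller end. Thus `h` is `lower` plus its image under `mate p`, and
  -- both have the same sum.
  lower : Fin n → Bool
  lower x = does (x <? mate p x) ∧ h x

  split : ∀ x → h x ≡ lower x xor lower (mate p x)
  split x rewrite involutive p x | inv x with Fin.<-cmp x (mate p x)
  ... | tri< x<y _ y≮x rewrite dec-true (x <? mate p x) x<y | dec-false (mate p x <? x) y≮x
    = sym (xor-identityʳ (h x))
  ... | tri≈ _ x≡y _ = contradiction (sym x≡y) (irreflex p x)
  ... | tri> x≮y _ y<x rewrite dec-false (x <? mate p x) x≮y | dec-true (mate p x <? x) y<x = refl

module _ {n : ℕ} (X : Map n) where
  open Map X
  private module S = Classes squares

  -- The square condition says that `f` after `v` has square one; for two involutions this is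
  -- commutation. Hence both orders of composition give the diagonal `z`.
  mate-comm : ∀ x → mate f (mate v x) ≡ mate v (mate f x)
  mate-comm x = begin
    mate f (mate v x)                                        ≡⟨ involutive v _ ⟨
    mate v (mate v (mate f (mate v x)))                      ≡⟨ cong (mate v) (involutive f _) ⟨
    mate v (mate f (mate f (mate v (mate f (mate v x)))))    ≡⟨ cong (λ y → mate v (mate f y)) (square x) ⟩
    mate v (mate f x)                                        ∎

  squareSum : (Fin n → Bool) → Fin n → Bool
  squareSum h x = (h x xor h (mate v x)) xor (h (mate f x) xor h (mate v (mate f x)))

  squareSum-v : ∀ h → Invariant v (squareSum h)
  squareSum-v h x rewrite mate-comm x | involutive v x | involutive v (mate f x) =
    solve 4 (λ a b c d → (b :+ a) :+ (d :+ c) := (a :+ b) :+ (c :+ d)) refl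
      (h x) (h (mate v x)) (h (mate f x)) (h (mate v (mate f x)))

  squareSum-f : ∀ h → Invariant f (squareSum h)
  squareSum-f h x rewrite involutive f x =
    solve 4 (λ a b c d → (c :+ d) :+ (a :+ b) := (a :+ b) :+ (c :+ d)) refl
      (h x) (h (mate v x)) (h (mate f x)) (h (mate v (mate f x)))

  private
    is : Fin n → Fin n → Bool
    is r x = does (x ≟ r)

    is-true : ∀ r x → x ≡ r → is r x ≡ true
    is-true r x = dec-true (x ≟ r)

    is-false : ∀ r x → x ≢ r → is r x ≡ false
    is-false r x = dec-false (x ≟ r)

  -- By invariance the sum may be taken at the representative, which occurs only once among the four
  -- vertices since `v`, `f` and `z` have no fixed points.
  squareSum-indicator : ∀ t x → squareSum (is (S.rep t)) x ≡ does (t ≟ S.class x)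
  squareSum-indicator t x with t ≟ S.class x
  ... | yes refl = begin
    squareSum (is r) x  ≡⟨ rep-invariant v f (squareSum-v (is r)) (squareSum-f (is r)) x ⟨
    squareSum (is r) r  ≡⟨ cong₂ _xor_
                             (cong₂ _xor_ (is-true r r refl) (is-false r (mate v r) (irreflex v r)))
                             (cong₂ _xor_ (is-false r (mate f r) (irreflex f r))
                                          (is-false r (mate z r) (irreflex z r))) ⟩
    true                ∎
    where r = S.rep (S.class x)
  ... | no t≢ = cong₂ _xor_
    (cong₂ _xor_ (off x refl) (off (mate v x) (class-invariantˡ v f x)))
    (cong₂ _xor_ (off (mate f x) (class-invariantʳ v f x)) (off (mate z x)
      (trans (class-invariantˡ v f (mate f x)) (class-invariantʳ v f x))))
    where
    off : ∀ y → S.class y ≡ S.class x → is (S.rep t) y ≡ false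
    off y e = is-false (S.rep t) y λ { refl → t≢ (trans (sym (S.class-rep t)) e) }

  -- The squares partition the vertices. Writing each four-term sum as a sum over all vertices,
  -- weighted by the indicator of the square, allows the summations to be exchanged; every vertex
  -- then selects its own square.
  sum-squareSum : ∀ h → sum (λ t → squareSum h (S.rep t)) ≡ sum h
  sum-squareSum h = begin
    sum (λ t → squareSum h (S.rep t))
      ≡⟨ sum-cong-≗ (λ t → expand (S.rep t)) ⟩
    sum (λ t → sum (λ x → squareSum (is (S.rep t)) x ∧ h x))
      ≡⟨ ∑-comm (λ t x → squareSum (is (S.rep t)) x ∧ h x) ⟩
    sum (λ x → sum (λ t → squareSum (is (S.rep t)) x ∧ h x))
      ≡⟨ sum-cong-≗ (λ x → trans
           (sum-cong-≗ (λ t → cong (_∧ h x) (squareSum-indicator t x)))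
           (sum-delta (S.class x) (λ _ → h x))) ⟩
    sum h ∎
    where
    delta : ∀ (p : Fin n → Fin n) → (∀ x → p (p x) ≡ x) → ∀ r → sum (λ x → is r (p x) ∧ h x) ≡ h (p r)
    delta p pp r = trans (sum-cong-≗ (λ x → cong (_∧ h x) (flip x))) (sum-delta (p r) h)
      where
      flip : ∀ x → is r (p x) ≡ is (p r) x
      flip x with x ≟ p r
      ... | yes refl = is-true r (p (p r)) (pp r)
      ... | no x≢    = is-false r (p x) λ { refl → x≢ (sym (pp x)) }

    expand : ∀ r → squareSum h r ≡ sum (λ x → squareSum (is r) x ∧ h x)
    expand r = begin
      squareSum h r
        ≡⟨ cong₂ _xor_
             (cong₂ _xor_ (delta (λ x → x) (λ _ → refl) r) (delta (mate v) (involutive v) r))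
             (cong₂ _xor_ (delta (mate f) (involutive f) r) (delta (mate z) (involutive z) r)) ⟨
      (sum h₁ xor sum h₂) xor (sum h₃ xor sum h₄)
        ≡⟨ cong₂ _xor_ (∑-distrib-+ h₁ h₂) (∑-distrib-+ h₃ h₄) ⟨
      sum (λ x → h₁ x xor h₂ x) xor sum (λ x → h₃ x xor h₄ x)
        ≡⟨ ∑-distrib-+ (λ x → h₁ x xor h₂ x) (λ x → h₃ x xor h₄ x) ⟨
      sum (λ x → (h₁ x xor h₂ x) xor (h₃ x xor h₄ x))
        ≡⟨ sum-cong-≗ (λ x → solve 5 (λ a b c d h →
             ((a :* h) :+ (b :* h)) :+ ((c :* h) :+ (d :* h)) := ((a :+ b) :+ (c :+ d)) :* h) refl
             (is r x) (is r (mate v x)) (is r (mate f x)) (is r (mate z x)) (h x)) ⟩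
      sum (λ x → squareSum (is r) x ∧ h x)
        ∎
      where
      h₁ h₂ h₃ h₄ : Fin n → Bool
      h₁ x = is r x ∧ h x
      h₂ x = is r (mate v x) ∧ h x
      h₃ x = is r (mate f x) ∧ h x
      h₄ x = is r (mate z x) ∧ h x

-- Sets of squares under different numberings

module _ {n : ℕ} (X : Map n) where
  private module S = Classes (Map.squares X)

  -- A set of squares as a function on vertices, the form in which sets belonging to different maps
  -- can be compared.
  at : Subset (Map.#squares X) → Fin n → Bool
  at A x = lookup A (S.class x)

  at-injective : ∀ {A B} → (∀ x → at A x ≡ at B x) → A ≡ B
  at-injective {A} {B} e = lookup-ext λ t →
    subst (λ s → lookup A s ≡ lookup B s) (S.class-rep t) (e (S.rep t))

-- The partition into squares of `Y` refines that of `X`. When this holds both ways, the squares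
-- agree as vertex sets and only their numbers differ.
_⊑_ : ∀ {n} → Map n → Map n → Set
X ⊑ Y = ∀ {x y} → Classes.class (Map.squares Y) x ≡ Classes.class (Map.squares Y) y →
                  Classes.class (Map.squares X) x ≡ Classes.class (Map.squares X) y

⊑-fromInvariant : ∀ {n} (X Y : Map n) → Invariant (Map.v Y) (Classes.class (Map.squares X)) →
                  Invariant (Map.f Y) (Classes.class (Map.squares X)) → X ⊑ Y
⊑-fromInvariant X Y v-inv f-inv e = SameCycle-invariant (Map.v Y) (Map.f Y) v-inv f-inv
  (Classes.exact (Map.squares Y) e)

⊑-dual : ∀ {n} (X : Map n) → X ⊑ dual X
⊑-dual X = ⊑-fromInvariant X (dual X) (class-invariantʳ v f) (class-invariantˡ v f)
  where open Map X

phial-⊑ : ∀ {n} (X : Map n) → phial X ⊑ X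
phial-⊑ X = ⊑-fromInvariant (phial X) X v-inv (class-invariantʳ z f)
  where
  open Map X
  v-inv : Invariant v (Classes.class (cycles z f))
  v-inv x = begin
    Classes.class (cycles z f) (mate v x)            ≡⟨ class-invariantʳ z f (mate v x) ⟨
    Classes.class (cycles z f) (mate f (mate v x))   ≡⟨ cong (Classes.class (cycles z f)) (mate-comm X x) ⟩
    Classes.class (cycles z f) (mate z x)            ≡⟨ class-invariantˡ z f x ⟩
    Classes.class (cycles z f) x                     ∎

⊑-phial : ∀ {n} (X : Map n) → X ⊑ phial X
⊑-phial X = ⊑-fromInvariant X (phial X)
  (λ x → trans (class-invariantˡ v f (mate f x)) (class-invariantʳ v f x)) (class-invariantʳ v f)
  where open Map X

lookup-transfer : ∀ {n} (X Y : Map n) A t → lookup (transfer X Y A) t ≡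
                  lookup A (Classes.class (Map.squares X) (Classes.rep (Map.squares Y) t))
lookup-transfer X Y A t = lookup∘tabulate _ t

transfer-linear : ∀ {n} (X Y : Map n) → Linear (transfer X Y)
transfer-linear X Y A B = lookup-ext λ t → begin
  lookup (transfer X Y (A ⊕ B)) t
    ≡⟨ lookup-transfer X Y (A ⊕ B) t ⟩
  lookup (A ⊕ B) _
    ≡⟨ lookup-zipWith _xor_ _ A B ⟩
  lookup A _ xor lookup B _
    ≡⟨ cong₂ _xor_ (lookup-transfer X Y A t) (lookup-transfer X Y B t) ⟨
  lookup (transfer X Y A) t xor lookup (transfer X Y B) t
    ≡⟨ lookup-zipWith _xor_ t (transfer X Y A) _ ⟨
  lookup (transfer X Y A ⊕ transfer X Y B) t
    ∎

module _ {n : ℕ} (X Y : Map n) (X⊑Y : X ⊑ Y) where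
  private
    module SX = Classes (Map.squares X)
    module SY = Classes (Map.squares Y)

  at-transfer : ∀ A x → at Y (transfer X Y A) x ≡ at X A x
  at-transfer A x = trans (lookup-transfer X Y A (SY.class x))
    (cong (lookup A) (X⊑Y (SY.class-rep (SY.class x))))

  transfer-transfer : Y ⊑ X → ∀ A → transfer Y X (transfer X Y A) ≡ A
  transfer-transfer Y⊑X A = at-injective X λ x → begin
    at X (transfer Y X (transfer X Y A)) x  ≡⟨ lookup-transfer Y X (transfer X Y A) (SX.class x) ⟩
    at Y (transfer X Y A) (SX.rep (SX.class x))
                                            ≡⟨ at-transfer A (SX.rep (SX.class x)) ⟩
    at X A (SX.rep (SX.class x))            ≡⟨ cong (lookup A) (SX.class-rep (SX.class x)) ⟩
    at X A x                                ∎

  transfer-· : Y ⊑ X → ∀ A B → transfer X Y A · transfer X Y B ≡ A · B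
  transfer-· Y⊑X A B = begin
    transfer X Y A · transfer X Y B
      ≡⟨ sum-cong-≗ (λ t → cong₂ _∧_ (lookup-transfer X Y A t) (lookup-transfer X Y B t)) ⟩
    sum (λ t → lookup A (SX.class (SY.rep t)) ∧ lookup B (SX.class (SY.rep t)))
      ≡⟨ sum-permute (λ s → lookup A s ∧ lookup B s) (permutation
           (λ t → SX.class (SY.rep t)) (λ s → SY.class (SX.rep s))
           (λ s → trans (X⊑Y (SY.class-rep _)) (SX.class-rep s))
           (λ t → trans (Y⊑X (SX.class-rep _)) (SY.class-rep t))) ⟨
    A · B
      ∎

-- A coboundary of G X is given by a two-colouring of the vertices of C that is
-- constant along v and a; the square through x lies in it when x and f x have
-- different colours.
record Cut {n : ℕ} (p q r : PerfectMatching n) (g : Fin n → Bool) : Set where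
  field
    colour     : Fin n → Bool
    invariantˡ : Invariant p colour
    invariantʳ : Invariant q colour
    cut        : ∀ x → g x ≡ colour x xor colour (mate r x)

Cut-cong : ∀ {n} {p q r : PerfectMatching n} {g h : Fin n → Bool} → (∀ x → g x ≡ h x) →
           Cut p q r g → Cut p q r h
Cut-cong g≗h K = record { Cut K ; cut = λ x → trans (sym (g≗h x)) (Cut.cut K x) }

-- Coboundaries as cuts, connectedness and sizes

module _ {n : ℕ} (X : Map n) where
  open Map X
  private
    module C = Classes (cycles v a)
    module S = Classes squares

  -- The ends of an edge of `G X` are read at the representative of its square. The function `∂` is
  -- constant on squares, so any vertex of the square serves.
  at-δ : ∀ U x → at X (δ (G X) U) x ≡ lookup U (C.class x) xor lookup U (C.class (mate f x))
  at-δ U x = trans (lookup∘tabulate _ (S.class x)) (rep-invariant v f {S = ∂} v-inv f-inv x)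
    where
    ∂ : Fin n → Bool
    ∂ x = lookup U (C.class x) xor lookup U (C.class (mate f x))
    v-inv : Invariant v ∂
    v-inv x = cong₂ (λ c d → lookup U c xor lookup U d) (class-invariantˡ v a x)
      (trans (cong C.class (mate-comm X x)) (class-invariantˡ v a (mate f x)))
    f-inv : Invariant f ∂
    f-inv x rewrite involutive f x = xor-comm (lookup U (C.class (mate f x))) _

  coboundary⇒cut : ∀ {A} → Coboundaries (G X) A → Cut v a f (at X A)
  coboundary⇒cut (U , refl) = record
    { colour     = λ x → lookup U (C.class x)
    ; invariantˡ = λ x → cong (lookup U) (class-invariantˡ v a x)
    ; invariantʳ = λ x → cong (lookup U) (class-invariantʳ v a x)
    ; cut        = at-δ U
    }

  cut⇒coboundary : ∀ {A} → Cut v a f (at X A) → Coboundaries (G X) A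
  cut⇒coboundary {A} K = U , at-injective X λ x → begin
    at X (δ (G X) U) x                                       ≡⟨ at-δ U x ⟩
    lookup U (C.class x) xor lookup U (C.class (mate f x))   ≡⟨ cong₂ _xor_ (lookup-U x)
                                                                  (lookup-U (mate f x)) ⟩
    colour x xor colour (mate f x)                           ≡⟨ cut x ⟨
    at X A x                                                 ∎
    where
    open Cut K
    U : Subset C.count
    U = tabulate (λ c → colour (C.rep c))
    lookup-U : ∀ x → lookup U (C.class x) ≡ colour x
    lookup-U x = trans (lookup∘tabulate _ (C.class x)) (rep-invariant v a invariantˡ invariantʳ x)

-- Connectedness of the cubic graph, phrased by colourings. In this form it passes between a map,
-- its dual and its phial.
Indivisible : ∀ {n} → Map n → Set
Indivisible {n} X =
  (S : Fin n → Bool) → Invariant v S → Invariant f S → Invariant a S → ∀ x y → S x ≡ S y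
  where open Map X

connected⇒indivisible : ∀ {n} (X : Map n) → Graph.Connected (G X) → Indivisible X
connected⇒indivisible X (_ , conn) S v-inv f-inv a-inv x y = begin
  S x                    ≡⟨ rep-invariant v a v-inv a-inv x ⟨
  S (C.rep (C.class x))  ≡⟨ Eq.gfold isEquivalence (S ∘ C.rep) step (conn (C.class x) (C.class y)) ⟩
  S (C.rep (C.class y))  ≡⟨ rep-invariant v a v-inv a-inv y ⟩
  S y                    ∎
  where
  open Map X
  module C = Classes (cycles v a)
  step : ∀ {c d} → Graph.Adjacent (G X) c d → S (C.rep c) ≡ S (C.rep d)
  step (e , refl) = begin
    S (C.rep (C.class r))            ≡⟨ rep-invariant v a v-inv a-inv r ⟩
    S r                              ≡⟨ f-inv r ⟨
    S (mate f r)                     ≡⟨ rep-invariant v a v-inv a-inv (mate f r) ⟨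
    S (C.rep (C.class (mate f r)))   ∎
    where r = Classes.rep squares e

module _ {n : ℕ} (X Y : Map n) (X⊑Y : X ⊑ Y) (Y⊑X : Y ⊑ X) where
  private
    module C = Classes (cycles (Map.v Y) (Map.a Y))

  transferred⇒cut : ∀ {A} → Coboundaries (G Y) (transfer X Y A) →
                    Cut (Map.v Y) (Map.a Y) (Map.f Y) (at X A)
  transferred⇒cut {A} A∈ = Cut-cong (at-transfer X Y X⊑Y A) (coboundary⇒cut Y A∈)

  cut⇒transferred : ∀ {A} → Cut (Map.v Y) (Map.a Y) (Map.f Y) (at X A) →
                    Coboundaries (G Y) (transfer X Y A)
  cut⇒transferred {A} K = cut⇒coboundary Y (Cut-cong (λ x → sym (at-transfer X Y X⊑Y A x)) K)

  transferred-isSubspace : IsSubspace (λ A → Coboundaries (G Y) (transfer X Y A))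
  transferred-isSubspace = preimage-isSubspace {W = Coboundaries (G Y)}
    (transfer-linear X Y) (Coboundaries-isSubspace (G Y))

  transferred? : Decidable (λ A → Coboundaries (G Y) (transfer X Y A))
  transferred? A = Coboundaries? (G Y) (transfer X Y A)

  -- The factor 2 is the kernel of δ, that is, the two constant colourings.
  transferred-size : Indivisible Y → Fin n → size transferred? * 2 ≡ 2 ^ Graph.#V (G Y)
  transferred-size indivisible x₀ = trans (cong (size transferred? *_) (sym kernel-size))
    (image-size transferred? φ-linear
      (λ U → U , sym (transfer-transfer Y X Y⊑X X⊑Y (δ (G Y) U)))
      (λ { A (U , e) → U , trans (cong (transfer Y X) e) (transfer-transfer X Y X⊑Y Y⊑X A) }))
    where
    φ : Subset C.count → Subset (Map.#squares X)
    φ U = transfer Y X (δ (G Y) U)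

    φ-linear : Linear φ
    φ-linear U W = trans (cong (transfer Y X) (δ-linear (G Y) U W))
      (transfer-linear Y X (δ (G Y) U) (δ (G Y) W))

    at-φ : ∀ U x → at X (φ U) x ≡ lookup U (C.class x) xor lookup U (C.class (mate (Map.f Y) x))
    at-φ U x = trans (at-transfer Y X Y⊑X (δ (G Y) U) x) (at-δ Y U x)

    constant∈ : ∀ b → φ (replicate C.count b) ≡ ⊥
    constant∈ b = at-injective X λ x → begin
      at X (φ (replicate C.count b)) x
        ≡⟨ at-φ (replicate C.count b) x ⟩
      lookup (replicate C.count b) (C.class x) xor lookup (replicate C.count b) (C.class (mate (Map.f Y) x))
        ≡⟨ cong₂ _xor_ (lookup-replicate (C.class x) b) (lookup-replicate (C.class (mate (Map.f Y) x)) b) ⟩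
      b xor b
        ≡⟨ xor-same b ⟩
      false
        ≡⟨ lookup-replicate (Classes.class (Map.squares X) x) false ⟨
      at X ⊥ x
        ∎

    constant : ∀ U → φ U ≡ ⊥ → U ≡ replicate C.count (lookup U (C.class x₀))
    constant U e = lookup-ext λ c → begin
      lookup U c                          ≡⟨ cong (lookup U) (C.class-rep c) ⟨
      lookup U (C.class (C.rep c))        ≡⟨ indivisible (λ x → lookup U (C.class x))
                                               v-inv f-inv a-inv (C.rep c) x₀ ⟩
      lookup U (C.class x₀)               ≡⟨ lookup-replicate c _ ⟨
      lookup (replicate C.count (lookup U (C.class x₀))) c  ∎
      where
      v-inv : Invariant (Map.v Y) (λ x → lookup U (C.class x))
      v-inv x = cong (lookup U) (class-invariantˡ (Map.v Y) (Map.a Y) x)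
      a-inv : Invariant (Map.a Y) (λ x → lookup U (C.class x))
      a-inv x = cong (lookup U) (class-invariantʳ (Map.v Y) (Map.a Y) x)
      f-inv : Invariant (Map.f Y) (λ x → lookup U (C.class x))
      f-inv x = sym (xor≡false (trans (sym (at-φ U x))
        (trans (cong (λ A → at X A x) e)
          (lookup-replicate (Classes.class (Map.squares X) x) false))))

    -- The vertex `x₀` keeps the two constant colourings apart; on an empty vertex set they would
    -- coincide and the kernel would have one member.
    ⊥≢⊤ : ⊥ {C.count} ≢ ⊤
    ⊥≢⊤ e = contradiction
      (trans (sym (lookup-replicate (C.class x₀) false))
        (trans (cong (λ U → lookup U (C.class x₀)) e) (lookup-replicate (C.class x₀) true))) λ ()

    pointwise : ∀ U → ι (φ U ≟ₛ ⊥) ≡ ι (U ≟ₛ ⊥) ℕ.+ ι (U ≟ₛ ⊤)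
    pointwise U with U ≟ₛ ⊥ | U ≟ₛ ⊤
    ... | yes refl | yes e    = contradiction e ⊥≢⊤
    ... | yes refl | no _     = ι-yes (φ ⊥ ≟ₛ ⊥) (constant∈ false)
    ... | no _     | yes refl = ι-yes (φ ⊤ ≟ₛ ⊥) (constant∈ true)
    ... | no U≢⊥   | no U≢⊤   = ι-no (φ U ≟ₛ ⊥) λ e → neither (lookup U (C.class x₀)) (constant U e)
      where
      neither : ∀ b → U ≢ replicate C.count b
      neither false = U≢⊥
      neither true  = U≢⊤

    kernel-size : size (λ U → φ U ≟ₛ ⊥) ≡ 2
    kernel-size = trans (total-cong {C.count} pointwise)
      (trans (total-+ {C.count} (λ U → ι (U ≟ₛ ⊥)) (λ U → ι (U ≟ₛ ⊤)))
        (cong₂ ℕ._+_ (size-singleton (⊥ {C.count})) (size-singleton (⊤ {C.count}))))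

-- Orthogonality of the three spaces, and absorption

module _ {n : ℕ} (X : Map n) where
  open Map X

  -- The edges of a pair off the vertices, so the values of h cancel.
  ·≡false : ∀ A B {h : Fin n → Bool} → Invariant a h →
            (∀ x → at X A x ∧ at X B x ≡ squareSum X h x) → A · B ≡ false
  ·≡false A B {h} inv e = begin
    A · B
      ≡⟨ sum-cong-≗ (λ t → cong (λ s → lookup A s ∧ lookup B s) (Classes.class-rep squares t)) ⟨
    sum (λ t → at X A (Classes.rep squares t) ∧ at X B (Classes.rep squares t))
      ≡⟨ sum-cong-≗ (λ t → e (Classes.rep squares t)) ⟩
    sum (λ t → squareSum X h (Classes.rep squares t))
      ≡⟨ sum-squareSum X h ⟩
    sum h
      ≡⟨ sum-invariant a inv ⟩
    false ∎

  -- At `x`, `v x`, `f x`, `z x` the colouring `S` takes values s, s, s′, s′ and `T` takes t, t′, t,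
  -- t′. All four products st occur once, and their sum factors as (s + s′)(t + t′).
  v-cut⊥f-cut : ∀ A B → Cut v a f (at X A) → Cut f a v (at X B) → A · B ≡ false
  v-cut⊥f-cut A B K L = ·≡false A B (λ x → cong₂ _∧_ (K.invariantʳ x) (L.invariantʳ x)) λ x → begin
    at X A x ∧ at X B x
      ≡⟨ cong₂ _∧_ (K.cut x) (L.cut x) ⟩
    (S x xor S (mate f x)) ∧ (T x xor T (mate v x))
      ≡⟨ solve 4 (λ s s′ t t′ → (s :+ s′) :* (t :+ t′) :=
           ((s :* t) :+ (s :* t′)) :+ ((s′ :* t) :+ (s′ :* t′))) refl
           (S x) (S (mate f x)) (T x) (T (mate v x)) ⟩
    ((S x ∧ T x) xor (S x ∧ T (mate v x))) xor ((S (mate f x) ∧ T x) xor (S (mate f x) ∧ T (mate v x)))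
      ≡⟨ cong₂ _xor_
           (cong ((S x ∧ T x) xor_) (cong (_∧ T (mate v x)) (K.invariantˡ x)))
           (cong₂ _xor_ (cong (S (mate f x) ∧_) (L.invariantˡ x))
             (cong₂ _∧_ (K.invariantˡ (mate f x))
               (trans (cong T (sym (mate-comm X x))) (L.invariantˡ (mate v x))))) ⟨
    squareSum X (λ x → S x ∧ T x) x
      ∎
    where
    module K = Cut K
    module L = Cut L
    S = K.colour
    T = L.colour

  -- The vertices `v x` and `f x` are the ends of the other diagonal.
  z-invariant : {S : Fin n → Bool} → Invariant z S → ∀ x → S (mate v x) ≡ S (mate f x)
  z-invariant {S} z-inv x = trans (cong (S ∘ mate v) (sym (involutive f x))) (z-inv (mate f x))

  -- Constant on diagonals, `R` takes values r, r′, r′, r at the same four vertices, and the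
  -- products again run over all combinations.
  v-cut⊥z-cut : ∀ A B → Cut v a f (at X A) → Cut z a f (at X B) → A · B ≡ false
  v-cut⊥z-cut A B K L = ·≡false A B (λ x → cong₂ _∧_ (K.invariantʳ x) (L.invariantʳ x)) λ x → begin
    at X A x ∧ at X B x
      ≡⟨ cong₂ _∧_ (K.cut x) (L.cut x) ⟩
    (S x xor S (mate f x)) ∧ (R x xor R (mate f x))
      ≡⟨ solve 4 (λ s s′ r r′ → (s :+ s′) :* (r :+ r′) :=
           ((s :* r) :+ (s :* r′)) :+ ((s′ :* r′) :+ (s′ :* r))) refl
           (S x) (S (mate f x)) (R x) (R (mate f x)) ⟩
    ((S x ∧ R x) xor (S x ∧ R (mate f x))) xor ((S (mate f x) ∧ R (mate f x)) xor (S (mate f x) ∧ R x))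
      ≡⟨ cong₂ _xor_
           (cong ((S x ∧ R x) xor_) (cong₂ _∧_ (K.invariantˡ x) (z-invariant L.invariantˡ x)))
           (cong ((S (mate f x) ∧ R (mate f x)) xor_)
             (cong₂ _∧_ (K.invariantˡ (mate f x)) (L.invariantˡ x))) ⟨
    squareSum X (λ x → S x ∧ R x) x
      ∎
    where
    module K = Cut K
    module L = Cut L
    S = K.colour
    R = L.colour

  f-cut⊥z-cut : ∀ A B → Cut f a v (at X A) → Cut z a f (at X B) → A · B ≡ false
  f-cut⊥z-cut A B K L = ·≡false A B (λ x → cong₂ _∧_ (K.invariantʳ x) (L.invariantʳ x)) λ x → begin
    at X A x ∧ at X B x
      ≡⟨ cong₂ _∧_ (K.cut x) (L.cut x) ⟩
    (T x xor T (mate v x)) ∧ (R x xor R (mate f x))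
      ≡⟨ solve 4 (λ t t′ r r′ → (t :+ t′) :* (r :+ r′) :=
           ((t :* r) :+ (t′ :* r′)) :+ ((t :* r′) :+ (t′ :* r))) refl
           (T x) (T (mate v x)) (R x) (R (mate f x)) ⟩
    ((T x ∧ R x) xor (T (mate v x) ∧ R (mate f x))) xor ((T x ∧ R (mate f x)) xor (T (mate v x) ∧ R x))
      ≡⟨ cong₂ _xor_
           (cong ((T x ∧ R x) xor_) (cong (T (mate v x) ∧_) (z-invariant L.invariantˡ x)))
           (cong₂ _xor_ (cong (_∧ R (mate f x)) (K.invariantˡ x))
             (cong₂ _∧_ (trans (cong T (sym (mate-comm X x))) (K.invariantˡ (mate v x)))
               (L.invariantˡ x))) ⟨
    squareSum X (λ x → T x ∧ R x) x
      ∎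
    where
    module K = Cut K
    module L = Cut L
    T = K.colour
    R = L.colour

  -- The witness is `S + R`. Both summands change by `g` along `f`, so their sum is constant there.
  -- Along `v` only `R` changes, and by `g`, since `R (mate v x)` equals `R (mate f x)`.
  absorption : ∀ {g} → Cut v a f g → Cut z a f g → Cut f a v g
  absorption {g} K L = record
    { colour     = T
    ; invariantˡ = λ x → xor≡false (begin
        T (mate f x) xor T x
          ≡⟨ solve 4 (λ s s′ r r′ → (s′ :+ r′) :+ (s :+ r) := (s :+ s′) :+ (r :+ r′)) refl
               (S x) (S (mate f x)) (R x) (R (mate f x)) ⟩
        (S x xor S (mate f x)) xor (R x xor R (mate f x))
          ≡⟨ cong₂ _xor_ (K.cut x) (L.cut x) ⟨
        g x xor g x
          ≡⟨ xor-same (g x) ⟩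
        false ∎)
    ; invariantʳ = λ x → cong₂ _xor_ (K.invariantʳ x) (L.invariantʳ x)
    ; cut        = λ x → begin
        g x
          ≡⟨ L.cut x ⟩
        R x xor R (mate f x)
          ≡⟨ cong (R x xor_) (z-invariant L.invariantˡ x) ⟨
        R x xor R (mate v x)
          ≡⟨ cong (_xor (R x xor R (mate v x))) (xor-same (S x)) ⟨
        (S x xor S x) xor (R x xor R (mate v x))
          ≡⟨ solve 4 (λ s s′ r r′ → (s :+ s′) :+ (r :+ r′) := (s :+ r) :+ (s′ :+ r′)) refl
               (S x) (S x) (R x) (R (mate v x)) ⟩
        T x xor (S x xor R (mate v x))
          ≡⟨ cong (λ s → T x xor (s xor R (mate v x))) (K.invariantˡ x) ⟨
        T x xor T (mate v x)
          ∎
    }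
    where
    module K = Cut K
    module L = Cut L
    S = K.colour
    R = L.colour
    T : Fin n → Bool
    T x = S x xor R x

-- Arithmetic of sizes and exponents

2^-cancel-≤ : ∀ {p q} → 2 ^ p ℕ.≤ 2 ^ q → p ℕ.≤ q
2^-cancel-≤ le = ℕ.≮⇒≥ λ q<p → ℕ.<⇒≱ (ℕ.^-monoʳ-< 2 ℕ.≤-refl q<p) le

-- The letters `v f z s i p k` stand for the sizes of V, F, Z, F + Z, F ∩ Z, V^⊥ and K, and `a b c`
-- for the vertex numbers of the three graphs. Multiplying `s * i` and `p * k` by `v * 8` makes both
-- powers of two; the 8 collects the three kernels of size 2.
module Sizes (v f z s i p k : ℕ) (a b c m γ : ℕ)
             (v≡ : v * 2 ≡ 2 ^ a) (f≡ : f * 2 ≡ 2 ^ b) (z≡ : z * 2 ≡ 2 ^ c) (k≡ : k ≡ 2 ^ γ)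
             (v*p≡ : v * p ≡ 2 ^ m) (s*i≡ : s * i ≡ f * z) (i≤k : i ℕ.≤ k) where

  private
    lhs : v * (s * i) * 8 ≡ 2 ^ (a ℕ.+ b ℕ.+ c)
    lhs = begin
      v * (s * i) * 8              ≡⟨ cong (λ x → v * x * 8) s*i≡ ⟩
      v * (f * z) * 8              ≡⟨ identity v f z ⟩
      (v * 2) * (f * 2) * (z * 2)  ≡⟨ cong₂ _*_ (cong₂ _*_ v≡ f≡) z≡ ⟩
      2 ^ a * 2 ^ b * 2 ^ c        ≡⟨ cong (_* 2 ^ c) (ℕ.^-distribˡ-+-* 2 a b) ⟨
      2 ^ (a ℕ.+ b) * 2 ^ c        ≡⟨ ℕ.^-distribˡ-+-* 2 (a ℕ.+ b) c ⟨
      2 ^ (a ℕ.+ b ℕ.+ c)          ∎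
      where
      identity : ∀ v f z → v * (f * z) * 8 ≡ (v * 2) * (f * 2) * (z * 2)
      identity = ℕ.solve-∀

    rhs : v * (p * k) * 8 ≡ 2 ^ (m ℕ.+ γ ℕ.+ 3)
    rhs = begin
      v * (p * k) * 8           ≡⟨ cong (_* 8) (ℕ.*-assoc v p k) ⟨
      v * p * k * 8             ≡⟨ cong₂ (λ x y → x * y * 8) v*p≡ k≡ ⟩
      2 ^ m * 2 ^ γ * 2 ^ 3     ≡⟨ cong (_* 2 ^ 3) (ℕ.^-distribˡ-+-* 2 m γ) ⟨
      2 ^ (m ℕ.+ γ) * 2 ^ 3     ≡⟨ ℕ.^-distribˡ-+-* 2 (m ℕ.+ γ) 3 ⟨
      2 ^ (m ℕ.+ γ ℕ.+ 3)       ∎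

  bound : s ℕ.≤ p → a ℕ.+ b ℕ.+ c ℕ.≤ m ℕ.+ γ ℕ.+ 3
  bound s≤p = 2^-cancel-≤
    (subst₂ ℕ._≤_ lhs rhs (ℕ.*-monoˡ-≤ 8 (ℕ.*-monoʳ-≤ v (ℕ.*-mono-≤ s≤p i≤k))))

  tight : s ≡ p → i ≡ k → a ℕ.+ b ℕ.+ c ≡ m ℕ.+ γ ℕ.+ 3
  tight refl refl = ℕ.≤-antisym
    (2^-cancel-≤ (ℕ.≤-reflexive 2^≡)) (2^-cancel-≤ (ℕ.≤-reflexive (sym 2^≡)))
    where
    2^≡ : 2 ^ (a ℕ.+ b ℕ.+ c) ≡ 2 ^ (m ℕ.+ γ ℕ.+ 3)
    2^≡ = trans (sym lhs) rhs

  -- Equality of the exponents gives `s * i ≡ p * k`, and then `i ≤ k` leaves `p * k ≤ s * k`.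
  tight⁻ : a ℕ.+ b ℕ.+ c ≡ m ℕ.+ γ ℕ.+ 3 → p ℕ.≤ s
  tight⁻ e = ℕ.*-cancelʳ-≤ p s k (ℕ.≤-trans (ℕ.≤-reflexive (sym s*i≡p*k)) (ℕ.*-monoʳ-≤ s i≤k))
    where
    instance
      v≢0 : ℕ.NonZero v
      v≢0 = ℕ.m*n≢0⇒m≢0 v {2} {{subst ℕ.NonZero (sym v≡) (ℕ.m^n≢0 2 a)}}
      k≢0 : ℕ.NonZero k
      k≢0 = subst ℕ.NonZero (sym k≡) (ℕ.m^n≢0 2 γ)
    s*i≡p*k : s * i ≡ p * k
    s*i≡p*k = ℕ.*-cancelˡ-≡ (s * i) (p * k) v
      (ℕ.*-cancelʳ-≡ _ _ 8 (trans lhs (trans (cong (2 ^_) e) (sym rhs))))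

module _ (a b c m γ : ℕ) where

  private
    -- Adding `m + c` to both sides clears the two subtractions.
    shift = + (m ℕ.+ c)

    χ-shift : + a - + m + + b ≡ + (a ℕ.+ b ℕ.+ c) - shift
    χ-shift = identity (+ a) (+ b) (+ c) (+ m)
      where
      identity : ∀ a b c m → a - m + b ≡ (a + b + c) - (m + c)
      identity = ℤ.solve-∀

    bound-shift : + 3 - + c + + γ ≡ + (m ℕ.+ γ ℕ.+ 3) - shift
    bound-shift = identity (+ c) (+ m) (+ γ) (+ 3)
      where
      identity : ∀ c m γ t → t - c + γ ≡ (m + γ + t) - (m + c)
      identity = ℤ.solve-∀

  χ-≤ : a ℕ.+ b ℕ.+ c ℕ.≤ m ℕ.+ γ ℕ.+ 3 → + a - + m + + b ≤ + 3 - + c + + γ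
  χ-≤ le = subst₂ _≤_ (sym χ-shift) (sym bound-shift) (ℤ.+-monoˡ-≤ (ℤ.- shift) (ℤ.+≤+ le))

  χ-≡ : a ℕ.+ b ℕ.+ c ≡ m ℕ.+ γ ℕ.+ 3 → + a - + m + + b ≡ + 3 - + c + + γ
  χ-≡ e = trans χ-shift (trans (cong (λ x → + x - shift) e) (sym bound-shift))

  χ-≡⁻ : + a - + m + + b ≡ + 3 - + c + + γ → a ℕ.+ b ℕ.+ c ≡ m ℕ.+ γ ℕ.+ 3
  χ-≡⁻ e = ℤ.+-injective (∙-cancelʳ (ℤ.- shift) _ _ (trans (sym χ-shift) (trans e bound-shift)))

-- The spaces of `P` and the bicycle space of its phial

module _ {n : ℕ} (P : Map n) where
  open Map P
  private
    D = dual P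
    M = phial P

  P⊑D : P ⊑ D
  P⊑D = ⊑-dual P
  D⊑P : D ⊑ P
  D⊑P = ⊑-dual D
  P⊑M : P ⊑ M
  P⊑M = ⊑-phial P
  M⊑P : M ⊑ P
  M⊑P = phial-⊑ P

  𝓥? : Decidable (𝓥 P)
  𝓥? = Coboundaries? (G P)
  𝓕? : Decidable (𝓕 P)
  𝓕? = transferred? P D P⊑D D⊑P
  𝓩? : Decidable (𝓩 P)
  𝓩? = transferred? P M P⊑M M⊑P

  𝓥-isSubspace : IsSubspace (𝓥 P)
  𝓥-isSubspace = Coboundaries-isSubspace (G P)
  𝓕-isSubspace : IsSubspace (𝓕 P)
  𝓕-isSubspace = transferred-isSubspace P D P⊑D D⊑P
  𝓩-isSubspace : IsSubspace (𝓩 P)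
  𝓩-isSubspace = transferred-isSubspace P M P⊑M M⊑P

  𝓕⇒cut : ∀ A → 𝓕 P A → Cut f a v (at P A)
  𝓕⇒cut A = transferred⇒cut P D P⊑D D⊑P {A}
  𝓩⇒cut : ∀ A → 𝓩 P A → Cut z a f (at P A)
  𝓩⇒cut A = transferred⇒cut P M P⊑M M⊑P {A}

  𝓥⊥𝓕 : ∀ A B → 𝓥 P A → 𝓕 P B → A · B ≡ false
  𝓥⊥𝓕 A B A∈ B∈ = v-cut⊥f-cut P A B (coboundary⇒cut P A∈) (𝓕⇒cut B B∈)
  𝓥⊥𝓩 : ∀ A B → 𝓥 P A → 𝓩 P B → A · B ≡ false
  𝓥⊥𝓩 A B A∈ B∈ = v-cut⊥z-cut P A B (coboundary⇒cut P A∈) (𝓩⇒cut B B∈)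
  𝓕⊥𝓩 : ∀ A B → 𝓕 P A → 𝓩 P B → A · B ≡ false
  𝓕⊥𝓩 A B A∈ B∈ = f-cut⊥z-cut P A B (𝓕⇒cut A A∈) (𝓩⇒cut B B∈)

  𝓕+𝓩⊆𝓥^⊥ : ∀ A → (𝓕 P +ₛ 𝓩 P) A → (𝓥 P ^⊥) A
  𝓕+𝓩⊆𝓥^⊥ _ (B , C , B∈ , C∈ , refl) = IsSubspace.⊕-∈ ^⊥-isSubspace {B} {C}
    (·≡false⇒^⊥ B λ {A} A∈ → trans (·-comm B A) (𝓥⊥𝓕 A B A∈ B∈))
    (·≡false⇒^⊥ C λ {A} A∈ → trans (·-comm C A) (𝓥⊥𝓩 A C A∈ C∈))

  -- The bicycle space of `G M` pulled back to the numbering of `P`, where it can be compared with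
  -- `𝓕 P` and `𝓩 P`.
  Bicycles′ : Space #squares
  Bicycles′ A = Bicycles (G M) (transfer P M A)

  -- A member of `𝓕 P` is orthogonal to all of `𝓩 P`, which makes it a cycle of `G M`; membership in
  -- `𝓩 P` supplies the coboundary half.
  𝓕∩𝓩⊆Bicycles′ : ∀ A → 𝓕 P A × 𝓩 P A → Bicycles′ A
  𝓕∩𝓩⊆Bicycles′ A (A∈𝓕 , A∈𝓩) =
    ^⊥⇒Cycles (G M) (transfer P M A) (·≡false⇒^⊥ (transfer P M A) orthogonal) , A∈𝓩
    where
    orthogonal : ∀ {B} → Coboundaries (G M) B → transfer P M A · B ≡ false
    orthogonal {B} B∈ = begin
      transfer P M A · B                               ≡⟨ cong (transfer P M A ·_) B≡ ⟨
      transfer P M A · transfer P M (transfer M P B)   ≡⟨ transfer-· P M P⊑M M⊑P A (transfer M P B) ⟩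
      A · transfer M P B                               ≡⟨ 𝓕⊥𝓩 A (transfer M P B) A∈𝓕
                                                            (subst (Coboundaries (G M)) (sym B≡) B∈) ⟩
      false                                            ∎
      where
      B≡ : transfer P M (transfer M P B) ≡ B
      B≡ = transfer-transfer M P M⊑P P⊑M B

  rich⇒Bicycles′⊆𝓕∩𝓩 : Rich P → ∀ A → Bicycles′ A → 𝓕 P A × 𝓩 P A
  rich⇒Bicycles′⊆𝓕∩𝓩 (𝓥^⊥⊆ , _) A (cycle , A∈𝓩) =
    cut⇒transferred P D P⊑D D⊑P {A} (absorption P (coboundary⇒cut P A∈𝓥) (𝓩⇒cut A A∈𝓩)) , A∈𝓩
    where
    -- Richness splits `C`. The part in `𝓕 P` is orthogonal to `A` because `A` lies in `𝓩 P`, and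
    -- the part in `𝓩 P` because `A` is a cycle of `G M`.
    orthogonal : ∀ C → (𝓥 P ^⊥) C → A · C ≡ false
    orthogonal C C⊥ with (B , B′ , B∈ , B′∈ , refl) ← 𝓥^⊥⊆ {C} C⊥ = begin
      A · (B ⊕ B′)      ≡⟨ ·-⊕ A B B′ ⟩
      A · B xor A · B′  ≡⟨ cong₂ _xor_ (trans (·-comm A B) (𝓕⊥𝓩 B A B∈ A∈𝓩))
                             (trans (sym (transfer-· P M P⊑M M⊑P A B′))
                               (^⊥⇒·≡false (transfer P M A) (Cycles⇒^⊥ (G M) (transfer P M A) cycle)
                                 {transfer P M B′} B′∈)) ⟩
      false             ∎
    A∈𝓥 : 𝓥 P A
    A∈𝓥 = ^⊥^⊥⊆ 𝓥? 𝓥-isSubspace A (·≡false⇒^⊥ A λ {C} → orthogonal C)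

  module _ (connected : Graph.Connected (G M)) where

    someVertex : Fin n
    someVertex = Classes.rep (cycles z a) (Fin.fromℕ< (ℕ.>-nonZero⁻¹ _ {{proj₁ connected}}))

    -- Since `z` is composed of `f` and `v`, a colouring constant along `v` and `f` is constant
    -- along `z`, and connectedness of `G M` applies.
    indivisible : Indivisible P
    indivisible S v-inv f-inv a-inv = connected⇒indivisible M connected S
      (λ x → trans (v-inv (mate f x)) (f-inv x)) f-inv a-inv

    -- Transfer from `P` to itself is the identity, which brings `𝓥 P` under the same count as the
    -- other two spaces.
    𝓥-size : size 𝓥? * 2 ≡ 2 ^ Graph.#V (G P)
    𝓥-size = trans
      (cong (_* 2) (size-cong 𝓥? (transferred? P P P⊑P P⊑P)
        (λ A → subst (𝓥 P) (sym (transfer-id A))) (λ A → subst (𝓥 P) (transfer-id A))))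
      (transferred-size P P P⊑P P⊑P indivisible someVertex)
      where
      P⊑P : P ⊑ P
      P⊑P e = e
      transfer-id : ∀ A → transfer P P A ≡ A
      transfer-id A = at-injective P (at-transfer P P P⊑P A)

    𝓕-size : size 𝓕? * 2 ≡ 2 ^ Graph.#V (G D)
    𝓕-size = transferred-size P D P⊑D D⊑P (λ S f-inv v-inv → indivisible S v-inv f-inv) someVertex

    𝓩-size : size 𝓩? * 2 ≡ 2 ^ Graph.#V (G M)
    𝓩-size = transferred-size P M P⊑M M⊑P (connected⇒indivisible M connected) someVertex

  module _ {γ : ℕ} (basis : HasDimension (Bicycles (G M)) γ) where

    Bicycles? : Decidable (Bicycles (G M))
    Bicycles? A = map′
      (λ { (cs , refl) → combination-∈ (Bicycles-isSubspace (G M)) (proj₁ basis)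
                           (IsBasis.members (proj₂ basis)) cs })
      (IsBasis.spanning (proj₂ basis) A)
      (anySubset? (λ cs → combination cs (proj₁ basis) ≟ₛ A))

    Bicycles′? : Decidable Bicycles′
    Bicycles′? A = Bicycles? (transfer P M A)

    -- Taking combinations of the basis is onto by spanning, and has trivial kernel by independence.
    Bicycles′-size : size Bicycles′? ≡ 2 ^ γ
    Bicycles′-size = begin
      size Bicycles′?                              ≡⟨ ℕ.*-identityʳ (size Bicycles′?) ⟨
      size Bicycles′? * 1                          ≡⟨ cong (size Bicycles′? *_) kernel-size ⟨
      size Bicycles′? * size (λ cs → φ cs ≟ₛ ⊥)    ≡⟨ image-size Bicycles′? φ-linear φ-∈ φ-onto ⟩
      2 ^ γ                                        ∎
      where
      open IsBasis (proj₂ basis)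
      comb : Subset γ → Subset (Map.#squares M)
      comb cs = combination cs (proj₁ basis)

      φ : Subset γ → Subset #squares
      φ cs = transfer M P (comb cs)

      transfer-φ : ∀ cs → transfer P M (φ cs) ≡ comb cs
      transfer-φ cs = transfer-transfer M P M⊑P P⊑M (comb cs)

      φ-linear : Linear φ
      φ-linear cs ds = trans (cong (transfer M P) (combination-linear (proj₁ basis) cs ds))
        (transfer-linear M P (comb cs) (comb ds))

      φ-∈ : ∀ cs → Bicycles′ (φ cs)
      φ-∈ cs = subst (Bicycles (G M)) (sym (transfer-φ cs))
        (combination-∈ (Bicycles-isSubspace (G M)) (proj₁ basis) members cs)

      φ-onto : ∀ A → Bicycles′ A → ∃[ cs ] φ cs ≡ A
      φ-onto A A∈ with (cs , e) ← spanning (transfer P M A) A∈ =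
        cs , trans (cong (transfer M P) e) (transfer-transfer P M P⊑M M⊑P A)

      kernel-size : size (λ cs → φ cs ≟ₛ ⊥) ≡ 1
      kernel-size = trans
        (size-cong (λ cs → φ cs ≟ₛ ⊥) (_≟ₛ ⊥)
          (λ cs e → independent cs
            (trans (sym (transfer-φ cs))
              (trans (cong (transfer P M) e) (linear-⊥ (transfer-linear P M)))))
          (λ { _ refl → linear-⊥ φ-linear }))
        (size-singleton (⊥ {γ}))

theorem2p10 : ∀ {n : ℕ} (P : Map n) →
    let M = phial P in
    Graph.Connected (G M) →
    ∀ (γ : ℕ) → HasDimension (Bicycles (G M)) γ →
    (χ P ≤ + 3 - + Graph.#V (G M) + + γ) ×
    ((χ P ≡ + 3 - + Graph.#V (G M) + + γ) ⇔ Rich P)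
theorem2p10 P connected γ basis =
    χ-≤ #V #F #Z m γ (bound (size-mono F+Z? V⊥? (𝓕+𝓩⊆𝓥^⊥ P)))
  , mk⇔ tight⇒rich rich⇒tight
  where
  #V = Graph.#V (G P)
  #F = Graph.#V (G (dual P))
  #Z = Graph.#V (G (phial P))
  m  = Map.#squares P

  V?   = 𝓥? P
  F?   = 𝓕? P
  Z?   = 𝓩? P
  K?   = Bicycles′? P basis
  V⊥?  = ^⊥? V?
  F+Z? = +ₛ? F? Z?
  F∩Z? = ∩? F? Z?

  F∩Z≤K : size F∩Z? ℕ.≤ size K?
  F∩Z≤K = size-mono F∩Z? K? (𝓕∩𝓩⊆Bicycles′ P)

  open Sizes (size V?) (size F?) (size Z?) (size F+Z?) (size F∩Z?) (size V⊥?) (size K?) #V #F #Z m γ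
    (𝓥-size P connected) (𝓕-size P connected) (𝓩-size P connected) (Bicycles′-size P basis)
    (size-^⊥ V? V⊥? (𝓥-isSubspace P)) (size-+ₛ F? Z? (𝓕-isSubspace P) (𝓩-isSubspace P)) F∩Z≤K

  rich⇒tight : Rich P → χ P ≡ + 3 - + #Z + + γ
  rich⇒tight rich = χ-≡ #V #F #Z m γ (tight
    (size-cong F+Z? V⊥? (𝓕+𝓩⊆𝓥^⊥ P) (λ A → proj₁ rich {A}))
    (size-cong F∩Z? K? (𝓕∩𝓩⊆Bicycles′ P) (rich⇒Bicycles′⊆𝓕∩𝓩 P rich)))

  tight⇒rich : χ P ≡ + 3 - + #Z + + γ → Rich P
  tight⇒rich e =
      (λ {A} → size-mono⁻ F+Z? V⊥? (𝓕+𝓩⊆𝓥^⊥ P) (tight⁻ (χ-≡⁻ #V #F #Z m γ e)) A)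
    , (λ {A} → 𝓕+𝓩⊆𝓥^⊥ P A)
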